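{- For every positive integer $r$, $$\sum_{n=1}^{\infty}\frac{1}{n(2n+2r-1)4^n}\frac{\binom{4n-2}{2n-1}}{\binom{2n+2r-2}{n+r-1}}=\frac{1}{(2r-1)\binom{2r-2}{r-1}}-\frac{1}{2^{2r-2}}I(r),$$ where $$I(r)=\frac{6\cdot 16^{r-1}}{r\binom{4r}{2r}}\left(\frac{4}{3}-\sqrt{2}\sum_{k=0}^{r-1} \frac{\binom{4k}{2k}}{(6k+3)16^k}\right).$$ -}

module Defs where

open import Data.Empty using (⊥-elim)
open import Data.Integer.Base as ℤ using (+_; +[1+_]; +≤+; +<+)
import Data.Integer.Properties as ℤ
open import Data.Nat.Base hiding (_/_)
open import Data.Nat.Combinatorics using (_C_; nCk+nC[k+1]≡[n+1]C[k+1])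
open import Data.Nat.Properties
open import Data.Nat.Solver using () renaming (module +-*-Solver to ℕ-Solver)
open import Data.Product.Base using (_×_; _,_; ∃-syntax; proj₁; proj₂)
open import Data.Rational.Base as ℚ using (ℚ; 0ℚ; 1ℚ; ½; mkℚ; toℚᵘ; _/_)
import Data.Rational.Properties as ℚ
open import Data.Rational.Solver using () renaming (module +-*-Solver to ℚ-Solver)
open import Data.Rational.Unnormalised.Base as ℚᵘ using (mkℚᵘ)
import Data.Rational.Unnormalised.Properties as ℚᵘ
open import Data.Sum.Base using (_⊎_; inj₁; inj₂)
open import Function.Base using (it)
open import Relation.Binary.PropositionalEquality
open import Relation.Nullary using (yes; no)

private
  half-pos : ∀ ε → 0ℚ ℚ.< ε → 0ℚ ℚ.< ½ ℚ.* ε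
  half-pos ε ε>0 = ℚ.positive⁻¹ _ {{ℚ.pos*pos⇒pos ½ ε {{ℚ.positive ε>0}}}}

  half+half : ∀ ε → ½ ℚ.* ε ℚ.+ ½ ℚ.* ε ≡ ε
  half+half ε = trans (sym (ℚ.*-distribʳ-+ ε ½ ½)) (ℚ.*-identityˡ ε)

  ∣∣-< : ∀ {p q} → p ℚ.< q → ℚ.- p ℚ.< q → ℚ.∣ p ∣ ℚ.< q
  ∣∣-< {p} {q} p<q -p<q with ℚ.∣p∣≡p∨∣p∣≡-p p
  ... | inj₁ eq = subst (ℚ._< q) (sym eq) p<q
  ... | inj₂ eq = subst (ℚ._< q) (sym eq) -p<q

  ∣∣-≤ : ∀ {p q} → p ℚ.≤ q → ℚ.- p ℚ.≤ q → ℚ.∣ p ∣ ℚ.≤ q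
  ∣∣-≤ {p} {q} p≤q -p≤q with ℚ.∣p∣≡p∨∣p∣≡-p p
  ... | inj₁ eq = subst (ℚ._≤ q) (sym eq) p≤q
  ... | inj₂ eq = subst (ℚ._≤ q) (sym eq) -p≤q

  neg-sub : ∀ p q → ℚ.- (p ℚ.- q) ≡ q ℚ.- p
  neg-sub = solve 2 (λ p q → :- (p :- q) := q :- p) refl
    where open ℚ-Solver

  ∣∣-sym : ∀ p q → ℚ.∣ p ℚ.- q ∣ ≡ ℚ.∣ q ℚ.- p ∣
  ∣∣-sym p q = trans (sym (ℚ.∣-p∣≡∣p∣ (p ℚ.- q))) (cong ℚ.∣_∣ (neg-sub p q))

  p<q+r⇒p-q<r : ∀ {p q r} → p ℚ.< q ℚ.+ r → p ℚ.- q ℚ.< r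
  p<q+r⇒p-q<r {p} {q} {r} h =
    subst (p ℚ.- q ℚ.<_) (lemma q r) (ℚ.+-monoˡ-< (ℚ.- q) h)
    where
    open ℚ-Solver
    lemma : ∀ q r → (q ℚ.+ r) ℚ.- q ≡ r
    lemma = solve 2 (λ q r → (q :+ r) :- q := r) refl

  p≤q+r⇒p-q≤r : ∀ {p q r} → p ℚ.≤ q ℚ.+ r → p ℚ.- q ℚ.≤ r
  p≤q+r⇒p-q≤r {p} {q} {r} h =
    subst (p ℚ.- q ℚ.≤_) (lemma q r) (ℚ.+-monoˡ-≤ (ℚ.- q) h)
    where
    open ℚ-Solver
    lemma : ∀ q r → (q ℚ.+ r) ℚ.- q ≡ r
    lemma = solve 2 (λ q r → (q :+ r) :- q := r) refl

  ∣p∣≤∣q∣+∣p-q∣ : ∀ p q → ℚ.∣ p ∣ ℚ.≤ ℚ.∣ q ∣ ℚ.+ ℚ.∣ p ℚ.- q ∣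
  ∣p∣≤∣q∣+∣p-q∣ p q =
    subst (λ t → ℚ.∣ t ∣ ℚ.≤ ℚ.∣ q ∣ ℚ.+ ℚ.∣ p ℚ.- q ∣) (lemma p q) (ℚ.∣p+q∣≤∣p∣+∣q∣ q (p ℚ.- q))
    where
    open ℚ-Solver
    lemma : ∀ p q → q ℚ.+ (p ℚ.- q) ≡ p
    lemma = solve 2 (λ p q → q :+ (p :- q) := p) refl

-- Real numbers are Cauchy sequences of rationals, with equality _≃ℝ_.
IsCauchy : (ℕ → ℚ) → Set
IsCauchy x = ∀ ε → 0ℚ ℚ.< ε → ∃[ N ] (∀ m n → N ≤ m → N ≤ n → ℚ.∣ x m ℚ.- x n ∣ ℚ.< ε)

record ℝ : Set where
  constructor mkℝ
  field
    seq    : ℕ → ℚ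
    cauchy : IsCauchy seq

open ℝ public

infix  4 _≃ℝ_ _≤ℝ_
infixl 6 _+ℝ_ _-ℝ_
infixl 7 _*ℝ_
infix  8 -ℝ_

_≃ℝ_ : ℝ → ℝ → Set
x ≃ℝ y = ∀ ε → 0ℚ ℚ.< ε → ∃[ N ] (∀ n → N ≤ n → ℚ.∣ seq x n ℚ.- seq y n ∣ ℚ.< ε)

_≤ℝ_ : ℝ → ℝ → Set
x ≤ℝ y = ∀ ε → 0ℚ ℚ.< ε → ∃[ N ] (∀ n → N ≤ n → seq x n ℚ.< seq y n ℚ.+ ε)

fromℚ : ℚ → ℝ
fromℚ q = mkℝ (λ _ → q) (λ ε ε>0 → 0 , λ _ _ _ _ →
  subst (λ t → ℚ.∣ t ∣ ℚ.< ε) (sym (ℚ.+-inverseʳ q)) ε>0)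

_+ℝ_ : ℝ → ℝ → ℝ
x +ℝ y = mkℝ (λ n → seq x n ℚ.+ seq y n) c
  where
  rearrange : ∀ a b c d → (a ℚ.- c) ℚ.+ (b ℚ.- d) ≡ (a ℚ.+ b) ℚ.- (c ℚ.+ d)
  rearrange = solve 4 (λ a b c d → (a :- c) :+ (b :- d) := (a :+ b) :- (c :+ d)) refl
    where open ℚ-Solver
  c : IsCauchy (λ n → seq x n ℚ.+ seq y n)
  c ε ε>0 with cauchy x (½ ℚ.* ε) (half-pos ε ε>0) | cauchy y (½ ℚ.* ε) (half-pos ε ε>0)
  ... | N₁ , h₁ | N₂ , h₂ = N₁ ⊔ N₂ , λ m n N≤m N≤n →
    subst₂ (λ t u → ℚ.∣ t ∣ ℚ.< u)
      (rearrange (seq x m) (seq y m) (seq x n) (seq y n)) (half+half ε)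
      (ℚ.≤-<-trans (ℚ.∣p+q∣≤∣p∣+∣q∣ (seq x m ℚ.- seq x n) (seq y m ℚ.- seq y n))
        (ℚ.+-mono-< (h₁ m n (m⊔n≤o⇒m≤o N₁ N₂ N≤m) (m⊔n≤o⇒m≤o N₁ N₂ N≤n))
                    (h₂ m n (m⊔n≤o⇒n≤o N₁ N₂ N≤m) (m⊔n≤o⇒n≤o N₁ N₂ N≤n))))

-ℝ_ : ℝ → ℝ
-ℝ x = mkℝ (λ n → ℚ.- seq x n) c
  where
  rearrange : ∀ a b → b ℚ.- a ≡ ℚ.- a ℚ.- (ℚ.- b)
  rearrange = solve 2 (λ a b → b :- a := (:- a) :- (:- b)) refl
    where open ℚ-Solver
  c : IsCauchy (λ n → ℚ.- seq x n)
  c ε ε>0 with cauchy x ε ε>0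
  ... | N , h = N , λ m n N≤m N≤n →
    subst (λ t → ℚ.∣ t ∣ ℚ.< ε) (rearrange (seq x m) (seq x n)) (h n m N≤n N≤m)

_-ℝ_ : ℝ → ℝ → ℝ
x -ℝ y = x +ℝ (-ℝ y)

∣_∣ℝ : ℝ → ℝ
∣ x ∣ℝ = mkℝ (λ n → ℚ.∣ seq x n ∣) c
  where
  c : IsCauchy (λ n → ℚ.∣ seq x n ∣)
  c ε ε>0 with cauchy x ε ε>0
  ... | N , h = N , λ m n N≤m N≤n → ℚ.≤-<-trans
    (bound (seq x m) (seq x n)) (h m n N≤m N≤n)
    where
    bound : ∀ p q → ℚ.∣ ℚ.∣ p ∣ ℚ.- ℚ.∣ q ∣ ∣ ℚ.≤ ℚ.∣ p ℚ.- q ∣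
    bound p q = ∣∣-≤
      (p≤q+r⇒p-q≤r (∣p∣≤∣q∣+∣p-q∣ p q))
      (subst₂ ℚ._≤_ (sym (neg-sub ℚ.∣ p ∣ ℚ.∣ q ∣)) (∣∣-sym q p)
        (p≤q+r⇒p-q≤r (∣p∣≤∣q∣+∣p-q∣ q p)))

private
  EventuallyBounded : (ℕ → ℚ) → ℚ → Set
  EventuallyBounded x B = ∃[ N ] (∀ n → N ≤ n → ℚ.∣ x n ∣ ℚ.≤ B)

  bounded : ∀ x → ∃[ B ] (0ℚ ℚ.< B × EventuallyBounded (seq x) B)
  bounded x with cauchy x 1ℚ (ℚ.positive⁻¹ 1ℚ)
  ... | N , h = ℚ.∣ seq x N ∣ ℚ.+ 1ℚ
              , ℚ.+-mono-≤-< (ℚ.0≤∣p∣ (seq x N)) (ℚ.positive⁻¹ 1ℚ)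
              , N , λ n N≤n → ℚ.≤-trans (∣p∣≤∣q∣+∣p-q∣ (seq x n) (seq x N))
                  (ℚ.+-monoʳ-≤ ℚ.∣ seq x N ∣ (ℚ.<⇒≤ (h n N N≤n ≤-refl)))

_*ℝ_ : ℝ → ℝ → ℝ
x *ℝ y = mkℝ (λ n → seq x n ℚ.* seq y n) c
  where
  rearrange : ∀ a b c d → a ℚ.* (b ℚ.- d) ℚ.+ d ℚ.* (a ℚ.- c) ≡ a ℚ.* b ℚ.- c ℚ.* d
  rearrange = solve 4 (λ a b c d → a :* (b :- d) :+ d :* (a :- c) := a :* b :- c :* d) refl
    where open ℚ-Solver

  module _ (B : ℚ) (B>0 : 0ℚ ℚ.< B) (ε : ℚ) (ε>0 : 0ℚ ℚ.< ε) where
    instance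
      posB : ℚ.Positive B
      posB = ℚ.positive B>0
      nzB : ℚ.NonZero B
      nzB = ℚ.pos⇒nonZero B

    δ : ℚ
    δ = ℚ.1/ B ℚ.* (½ ℚ.* ε)

    δ>0 : 0ℚ ℚ.< δ
    δ>0 = ℚ.positive⁻¹ δ {{ℚ.pos*pos⇒pos (ℚ.1/ B) {{ℚ.1/pos⇒pos B}} (½ ℚ.* ε) {{ℚ.positive (half-pos ε ε>0)}}}}

    Bδ : B ℚ.* δ ≡ ½ ℚ.* ε
    Bδ = trans (sym (ℚ.*-assoc B (ℚ.1/ B) (½ ℚ.* ε)))
      (trans (cong (ℚ._* (½ ℚ.* ε)) (ℚ.*-inverseʳ B)) (ℚ.*-identityˡ (½ ℚ.* ε)))

    product : ∀ p q → ℚ.∣ p ∣ ℚ.≤ B → ℚ.∣ q ∣ ℚ.< δ → ℚ.∣ p ℚ.* q ∣ ℚ.< ½ ℚ.* ε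
    product p q p≤B q<δ = subst₂ ℚ._<_ (sym (ℚ.∣p*q∣≡∣p∣*∣q∣ p q)) Bδ
      (ℚ.≤-<-trans (ℚ.*-monoʳ-≤-nonNeg ℚ.∣ q ∣ {{ℚ.∣-∣-nonNeg q}} p≤B) (ℚ.*-monoʳ-<-pos B q<δ))

  split : ∀ ε a b c d → ℚ.∣ a ℚ.* (b ℚ.- d) ∣ ℚ.< ½ ℚ.* ε → ℚ.∣ d ℚ.* (a ℚ.- c) ∣ ℚ.< ½ ℚ.* ε →
          ℚ.∣ a ℚ.* b ℚ.- c ℚ.* d ∣ ℚ.< ε
  split ε a b c d h₁ h₂ = subst₂ (λ t u → ℚ.∣ t ∣ ℚ.< u) (rearrange a b c d) (half+half ε)
    (ℚ.≤-<-trans (ℚ.∣p+q∣≤∣p∣+∣q∣ (a ℚ.* (b ℚ.- d)) (d ℚ.* (a ℚ.- c))) (ℚ.+-mono-< h₁ h₂))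

  c : IsCauchy (λ n → seq x n ℚ.* seq y n)
  c ε ε>0 =
    let B₁ , B₁>0 , N₁ , b₁ = bounded x
        B₂ , B₂>0 , N₂ , b₂ = bounded y
        N₃ , h₃ = cauchy x (δ B₂ B₂>0 ε ε>0) (δ>0 B₂ B₂>0 ε ε>0)
        N₄ , h₄ = cauchy y (δ B₁ B₁>0 ε ε>0) (δ>0 B₁ B₁>0 ε ε>0)
    in (N₁ ⊔ N₂) ⊔ (N₃ ⊔ N₄) , λ m n N≤m N≤n →
      let m₁ = m⊔n≤o⇒m≤o (N₁ ⊔ N₂) (N₃ ⊔ N₄) N≤m
          m₂ = m⊔n≤o⇒n≤o (N₁ ⊔ N₂) (N₃ ⊔ N₄) N≤m
          n₁ = m⊔n≤o⇒m≤o (N₁ ⊔ N₂) (N₃ ⊔ N₄) N≤n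
          n₂ = m⊔n≤o⇒n≤o (N₁ ⊔ N₂) (N₃ ⊔ N₄) N≤n
      in split ε (seq x m) (seq y m) (seq x n) (seq y n)
           (product B₁ B₁>0 ε ε>0 (seq x m) (seq y m ℚ.- seq y n) (b₁ m (m⊔n≤o⇒m≤o N₁ N₂ m₁))
             (h₄ m n (m⊔n≤o⇒n≤o N₃ N₄ m₂) (m⊔n≤o⇒n≤o N₃ N₄ n₂)))
           (product B₂ B₂>0 ε ε>0 (seq y n) (seq x m ℚ.- seq x n) (b₂ n (m⊔n≤o⇒n≤o N₁ N₂ n₁))
             (h₃ m n (m⊔n≤o⇒m≤o N₃ N₄ m₂) (m⊔n≤o⇒m≤o N₃ N₄ n₂)))

infix 4 _⟶_ ∑₁∞_≃_

_⟶_ : (ℕ → ℝ) → ℝ → Set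
s ⟶ L = ∀ ε → 0ℚ ℚ.< ε → ∃[ N ] (∀ n → N ≤ n → ∣ s n -ℝ L ∣ℝ ≤ℝ fromℚ ε)

-- ∑< n f = f 0 + ⋯ + f (n - 1)
∑< : ℕ → (ℕ → ℚ) → ℚ
∑< zero    f = 0ℚ
∑< (suc n) f = ∑< n f ℚ.+ f n

-- ∑₁ N f = f 1 + ⋯ + f N
∑₁ : ℕ → ((n : ℕ) → .{{NonZero n}} → ℚ) → ℚ
∑₁ zero    f = 0ℚ
∑₁ (suc N) f = ∑₁ N f ℚ.+ f (suc N)

-- f 1 + f 2 + ⋯ converges, with sum L
∑₁∞_≃_ : ((n : ℕ) → .{{NonZero n}} → ℚ) → ℝ → Set
∑₁∞ f ≃ L = (λ N → fromℚ (∑₁ N f)) ⟶ L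

-- ⌊√ m ⌋
isqrt : ℕ → ℕ
isqrt zero = 0
isqrt (suc m) with suc (isqrt m) * suc (isqrt m) ≤? suc m
... | yes _ = suc (isqrt m)
... | no  _ = isqrt m

private
  isqrt-lower : ∀ m → isqrt m * isqrt m ≤ m
  isqrt-lower zero = z≤n
  isqrt-lower (suc m) with suc (isqrt m) * suc (isqrt m) ≤? suc m
  ... | yes p = p
  ... | no  _ = m≤n⇒m≤1+n (isqrt-lower m)

  isqrt-upper : ∀ m → m < suc (isqrt m) * suc (isqrt m)
  isqrt-upper zero = s≤s z≤n
  isqrt-upper (suc m) with suc (isqrt m) * suc (isqrt m) ≤? suc m
  ... | yes p = ≤-<-trans (isqrt-upper m) (*-mono-< (n<1+n (suc (isqrt m))) (n<1+n (suc (isqrt m))))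
  ... | no ¬p = ≰⇒> ¬p

  sq-cancel-< : ∀ a b → a * a < b * b → a < b
  sq-cancel-< a b h with a <? b
  ... | yes p = p
  ... | no ¬p = ⊥-elim (<⇒≱ h (*-mono-≤ (≮⇒≥ ¬p) (≮⇒≥ ¬p)))

  sq-cancel-≤ : ∀ {a b} → a * a ≤ b * b → a ≤ b
  sq-cancel-≤ {a} {b} h with a ≤? b
  ... | yes p = p
  ... | no ¬p = ⊥-elim (≤⇒≯ h (*-mono-< (≰⇒> ¬p) (≰⇒> ¬p)))

  toℚᵘ-/ : ∀ a m → toℚᵘ (+ a / suc m) ℚᵘ.≃ mkℚᵘ (+ a) m
  toℚᵘ-/ a m = ℚ.toℚᵘ-fromℚᵘ (mkℚᵘ (+ a) m)

  frac-< : ∀ a b m n → a * suc n < b * suc m → + a / suc m ℚ.< + b / suc n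
  frac-< a b m n h = ℚ.toℚᵘ-cancel-<
    (ℚᵘ.<-respˡ-≃ (ℚᵘ.≃-sym (toℚᵘ-/ a m)) (ℚᵘ.<-respʳ-≃ (ℚᵘ.≃-sym (toℚᵘ-/ b n))
      (ℚᵘ.*<* (subst₂ ℤ._<_ (ℤ.pos-* a (suc n)) (ℤ.pos-* b (suc m)) (+<+ h)))))

  frac-≤ : ∀ a b m n → a * suc n ≤ b * suc m → + a / suc m ℚ.≤ + b / suc n
  frac-≤ a b m n h = ℚ.toℚᵘ-cancel-≤
    (ℚᵘ.≤-respˡ-≃ (ℚᵘ.≃-sym (toℚᵘ-/ a m)) (ℚᵘ.≤-respʳ-≃ (ℚᵘ.≃-sym (toℚᵘ-/ b n))
      (ℚᵘ.*≤* (subst₂ ℤ._≤_ (ℤ.pos-* a (suc n)) (ℤ.pos-* b (suc m)) (+≤+ h)))))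

  frac-+ : ∀ a b m n → + a / suc m ℚ.+ + b / suc n ≡ + (a * suc n + b * suc m) / (suc m * suc n)
  frac-+ a b m n = ℚ.toℚᵘ-injective (ℚᵘ.≃-trans (ℚ.toℚᵘ-homo-+ (+ a / suc m) (+ b / suc n))
    (ℚᵘ.≃-trans (ℚᵘ.+-cong (toℚᵘ-/ a m) (toℚᵘ-/ b n))
      (ℚᵘ.≃-trans (ℚᵘ.≃-reflexive (cong (λ z → mkℚᵘ z (n + m * suc n)) num))
        (ℚᵘ.≃-sym (toℚᵘ-/ (a * suc n + b * suc m) (n + m * suc n))))))
    where
    num : + a ℤ.* + suc n ℤ.+ + b ℤ.* + suc m ≡ + (a * suc n + b * suc m)
    num = trans (cong₂ ℤ._+_ (sym (ℤ.pos-* a (suc n))) (sym (ℤ.pos-* b (suc m))))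
                (sym (ℤ.pos-+ (a * suc n) (b * suc m)))

  frac-* : ∀ a b m n → + a / suc m ℚ.* (+ b / suc n) ≡ + (a * b) / (suc m * suc n)
  frac-* a b m n = ℚ.toℚᵘ-injective (ℚᵘ.≃-trans (ℚ.toℚᵘ-homo-* (+ a / suc m) (+ b / suc n))
    (ℚᵘ.≃-trans (ℚᵘ.*-cong (toℚᵘ-/ a m) (toℚᵘ-/ b n))
      (ℚᵘ.≃-trans (ℚᵘ.≃-reflexive (cong (λ z → mkℚᵘ z (n + m * suc n)) (sym (ℤ.pos-* a b))))
        (ℚᵘ.≃-sym (toℚᵘ-/ (a * b) (n + m * suc n))))))

  archimedean : ∀ c ε → 0ℚ ℚ.< ε → ∃[ N ] (∀ n → N ≤ n → + c / suc n ℚ.< ε)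
  archimedean c ε@(mkℚ (+ zero) _ _) (ℚ.*<* (+<+ ()))
  archimedean c ε@(mkℚ (+[1+ p ]) d _) ε>0 = c * suc d , λ n N≤n →
    ℚ.toℚᵘ-cancel-< (ℚᵘ.<-respˡ-≃ (ℚᵘ.≃-sym (toℚᵘ-/ c n))
      (ℚᵘ.*<* (subst (ℤ._< +[1+ p ] ℤ.* + suc n) (ℤ.pos-* c (suc d))
        (+<+ (<-≤-trans (s≤s N≤n) (m≤n*m (suc n) (suc p)))))))
  archimedean c ε@(mkℚ (ℤ.-[1+ p ]) _ _) (ℚ.*<* ())

√-seq : ℕ → ℕ → ℚ
√-seq k n = + isqrt (k * (suc n * suc n)) / suc n

private
  √-seq-< : ∀ k m n → √-seq k m ℚ.< √-seq k n ℚ.+ + 1 / suc n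
  √-seq-< k m n = subst (√-seq k m ℚ.<_) (sym (frac-+ a 1 n n)) (frac-< b (a * suc n + 1 * suc n) m (n + n * suc n) (begin-strict
      b * (suc n * suc n)           ≡⟨ solve 2 (λ b N → b :* (N :* N) := b :* N :* N) refl b (suc n) ⟩
      b * suc n * suc n             <⟨ *-monoˡ-< (suc n) (sq-cancel-< (b * suc n) (suc a * suc m) key) ⟩
      suc a * suc m * suc n         ≡⟨ solve 3 (λ a M N → (con 1 :+ a) :* M :* N := (a :* N :+ con 1 :* N) :* M) refl a (suc m) (suc n) ⟩
      (a * suc n + 1 * suc n) * suc m ∎))
    where
    open ≤-Reasoning
    open ℕ-Solver
    a = isqrt (k * (suc n * suc n))
    b = isqrt (k * (suc m * suc m))
    key : (b * suc n) * (b * suc n) < (suc a * suc m) * (suc a * suc m)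
    key = begin-strict
      (b * suc n) * (b * suc n)               ≡⟨ solve 2 (λ b N → (b :* N) :* (b :* N) := (b :* b) :* (N :* N)) refl b (suc n) ⟩
      (b * b) * (suc n * suc n)               ≤⟨ *-monoˡ-≤ (suc n * suc n) (isqrt-lower (k * (suc m * suc m))) ⟩
      (k * (suc m * suc m)) * (suc n * suc n) ≡⟨ solve 3 (λ k M N → (k :* (M :* M)) :* (N :* N) := (k :* (N :* N)) :* (M :* M)) refl k (suc m) (suc n) ⟩
      (k * (suc n * suc n)) * (suc m * suc m) <⟨ *-monoˡ-< (suc m * suc m) (isqrt-upper (k * (suc n * suc n))) ⟩
      (suc a * suc a) * (suc m * suc m)       ≡⟨ solve 2 (λ a M → (a :* a) :* (M :* M) := (a :* M) :* (a :* M)) refl (suc a) (suc m) ⟩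
      (suc a * suc m) * (suc a * suc m)       ∎

  √-seq-cauchy : ∀ k → IsCauchy (√-seq k)
  √-seq-cauchy k ε ε>0 with archimedean 1 ε ε>0
  ... | N , h = N , λ m n N≤m N≤n → ∣∣-<
    (ℚ.<-trans (p<q+r⇒p-q<r (√-seq-< k m n)) (h n N≤n))
    (subst (ℚ._< ε) (sym (neg-sub (√-seq k m) (√-seq k n)))
      (ℚ.<-trans (p<q+r⇒p-q<r (√-seq-< k n m)) (h m N≤m)))

-- The n-th approximation to √ k is ⌊(n + 1)√k⌋ / (n + 1).
√_ : ℕ → ℝ
√ k = mkℝ (√-seq k) (√-seq-cauchy k)

√-nonNeg : ∀ k → fromℚ 0ℚ ≤ℝ √ k
√-nonNeg k ε ε>0 = 0 , λ n _ → ℚ.+-mono-≤-<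
  (ℚ.nonNegative⁻¹ (√-seq k n) {{ℚ.normalize-nonNeg (isqrt (k * (suc n * suc n))) (suc n)}}) ε>0

√-square : ∀ k → √ k *ℝ √ k ≃ℝ fromℚ (+ k / 1)
√-square k ε ε>0 with archimedean (2 * k) ε ε>0
... | N , h = N , λ n N≤n → ∣∣-<
  (ℚ.≤-<-trans (p≤q+r⇒p-q≤r (subst (√-seq k n ℚ.* √-seq k n ℚ.≤_) (sym (ℚ.+-identityʳ _)) (lower n))) ε>0)
  (subst (ℚ._< ε) (sym (neg-sub (√-seq k n ℚ.* √-seq k n) (+ k / 1)))
    (ℚ.≤-<-trans (p≤q+r⇒p-q≤r (upper n)) (h n N≤n)))
  where
  open ≤-Reasoning
  open ℕ-Solver
  a : ℕ → ℕ
  a n = isqrt (k * (suc n * suc n))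

  lower : ∀ n → √-seq k n ℚ.* √-seq k n ℚ.≤ + k / 1
  lower n = subst (ℚ._≤ + k / 1) (sym (frac-* (a n) (a n) n n)) (frac-≤ (a n * a n) k (n + n * suc n) 0 (begin
    a n * a n * 1       ≡⟨ *-identityʳ (a n * a n) ⟩
    a n * a n           ≤⟨ isqrt-lower (k * (suc n * suc n)) ⟩
    k * (suc n * suc n) ∎))

  k≤k*k : ∀ k → k ≤ k * k
  k≤k*k zero    = z≤n
  k≤k*k (suc k) = m≤m*n (suc k) (suc k)

  a≤ : ∀ n → a n ≤ k * suc n
  a≤ n = sq-cancel-≤ (begin
    a n * a n                 ≤⟨ isqrt-lower (k * (suc n * suc n)) ⟩
    k * (suc n * suc n)       ≤⟨ *-monoˡ-≤ (suc n * suc n) (k≤k*k k) ⟩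
    k * k * (suc n * suc n)   ≡⟨ solve 2 (λ k N → k :* k :* (N :* N) := k :* N :* (k :* N)) refl k (suc n) ⟩
    k * suc n * (k * suc n)   ∎)

  key : ∀ n → k * (suc n * suc n) ≤ a n * a n + 2 * k * suc n
  key n = begin
    k * (suc n * suc n)             ≤⟨ s≤s⁻¹ (isqrt-upper (k * (suc n * suc n))) ⟩
    a n + a n * suc (a n)           ≡⟨ solve 1 (λ a → a :+ a :* (con 1 :+ a) := a :* a :+ con 2 :* a) refl (a n) ⟩
    a n * a n + 2 * a n             ≤⟨ +-monoʳ-≤ (a n * a n) (*-monoʳ-≤ 2 (a≤ n)) ⟩
    a n * a n + 2 * (k * suc n)     ≡⟨ cong (λ t → a n * a n + t) (sym (*-assoc 2 k (suc n))) ⟩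
    a n * a n + 2 * k * suc n       ∎

  upper : ∀ n → + k / 1 ℚ.≤ √-seq k n ℚ.* √-seq k n ℚ.+ + (2 * k) / suc n
  upper n = subst (+ k / 1 ℚ.≤_)
    (sym (trans (cong (ℚ._+ + (2 * k) / suc n) (frac-* (a n) (a n) n n))
                (frac-+ (a n * a n) (2 * k) (n + n * suc n) n)))
    (frac-≤ k (a n * a n * suc n + 2 * k * (suc n * suc n)) 0 (n + (n + n * suc n) * suc n) (begin
      k * (suc n * suc n * suc n)                                   ≡⟨ sym (*-assoc k (suc n * suc n) (suc n)) ⟩
      k * (suc n * suc n) * suc n                                   ≤⟨ *-monoˡ-≤ (suc n) (key n) ⟩
      (a n * a n + 2 * k * suc n) * suc n                           ≡⟨ solve 3 (λ a k N → (a :* a :+ con 2 :* k :* N) :* N := (a :* a :* N :+ con 2 :* k :* (N :* N)) :* con 1) refl (a n) k (suc n) ⟩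
      (a n * a n * suc n + 2 * k * (suc n * suc n)) * 1             ∎))

C≢0 : ∀ {n k} → k ≤ n → NonZero (n C k)
C≢0 {n} {zero} z≤n = _
C≢0 {suc n} {suc k} (s≤s k≤n) =
  subst NonZero (nCk+nC[k+1]≡[n+1]C[k+1] n k) (+-nonZeroˡ (C≢0 k≤n))
  where
  +-nonZeroˡ : ∀ {a b} → NonZero a → NonZero (a + b)
  +-nonZeroˡ {suc _} _ = _

private
  m∸1≤2m∸2 : ∀ m → m ∸ 1 ≤ 2 * m ∸ 2
  m∸1≤2m∸2 zero    = z≤n
  m∸1≤2m∸2 (suc m) rewrite +-suc m (m + 0) = m≤m+n m (m + 0)

  2m∸1≢0 : ∀ m → .{{NonZero m}} → NonZero (2 * m ∸ 1)
  2m∸1≢0 (suc m) rewrite +-suc m (m + 0) = _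

  n+r≢0 : ∀ n r → .{{NonZero n}} → NonZero (n + r)
  n+r≢0 (suc n) r = _

centralC≢0 : ∀ r → NonZero ((2 * r ∸ 2) C (r ∸ 1))
centralC≢0 r = C≢0 (m∸1≤2m∸2 r)

leadDenom≢0 : ∀ r → .{{NonZero r}} → NonZero ((2 * r ∸ 1) * ((2 * r ∸ 2) C (r ∸ 1)))
leadDenom≢0 r = m*n≢0 (2 * r ∸ 1) _ {{2m∸1≢0 r}} {{centralC≢0 r}}

summandDenom≢0 : ∀ r n → .{{NonZero n}} → NonZero (n * (2 * n + 2 * r ∸ 1) * 4 ^ n)
summandDenom≢0 r n =
  m*n≢0 (n * (2 * n + 2 * r ∸ 1)) (4 ^ n) {{m*n≢0 n (2 * n + 2 * r ∸ 1) {{it}} {{odd}}}} {{m^n≢0 4 n}}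
  where
  odd : NonZero (2 * n + 2 * r ∸ 1)
  odd = subst (λ t → NonZero (t ∸ 1)) (*-distribˡ-+ 2 n r) (2m∸1≢0 (n + r) {{n+r≢0 n r}})

summandC≢0 : ∀ r n → NonZero ((2 * n + 2 * r ∸ 2) C (n + r ∸ 1))
summandC≢0 r n = C≢0 (subst (λ t → n + r ∸ 1 ≤ t ∸ 2) (*-distribˡ-+ 2 n r) (m∸1≤2m∸2 (n + r)))

prefactorDenom≢0 : ∀ r → .{{NonZero r}} → NonZero (r * ((4 * r) C (2 * r)))
prefactorDenom≢0 r = m*n≢0 r _ {{it}} {{C≢0 (*-monoˡ-≤ r {2} {4} (s≤s (s≤s z≤n)))}}

innerDenom≢0 : ∀ k → NonZero ((6 * k + 3) * 16 ^ k)
innerDenom≢0 k = m*n≢0 (6 * k + 3) (16 ^ k) {{subst NonZero (+-comm 3 (6 * k)) _}} {{m^n≢0 16 k}}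

summand : (r n : ℕ) → .{{NonZero n}} → ℚ
summand r n =
  (+ 1 / (n * (2 * n + 2 * r ∸ 1) * 4 ^ n)) {{summandDenom≢0 r n}}
  ℚ.* (+ ((4 * n ∸ 2) C (2 * n ∸ 1)) / ((2 * n + 2 * r ∸ 2) C (n + r ∸ 1))) {{summandC≢0 r n}}

I : (r : ℕ) → .{{NonZero r}} → ℝ
I r =
  fromℚ ((+ (6 * 16 ^ (r ∸ 1)) / (r * ((4 * r) C (2 * r)))) {{prefactorDenom≢0 r}})
  *ℝ (fromℚ (+ 4 / 3)
      -ℝ √ 2 *ℝ fromℚ (∑< r (λ k → (+ ((4 * k) C (2 * k)) / ((6 * k + 3) * 16 ^ k)) {{innerDenom≢0 k}})))

{-# OPTIONS --safe #-}
module Submission where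

-- Put u n = C(2n,n) / 4ⁿ.  Up to a factor depending only on r, the n-th summand is
--   g(n,r) = u(2n) u(2r) r / ((4n - 1) (n + r) u(n + r)),
-- and g has the Wilf–Zeilberger mate
--   E(n,r) = u(2r) y(n,r) / (4 (2r + 1)),  y(n,r) = u(2n) (4n + 1) / (u(n + r) (2n + 2r + 1)),
-- in the sense that E(n,r) - E(n-1,r) = g(n,r+1) - g(n,r).  Since g(n,0) = 0, telescoping in both
-- variables expresses the N-th partial sum exactly through ∑_{k<r} E(N,k): it is the claimed value
-- with √2 replaced by y(N,k) in the k-th term of I(r).  Finally y(N,k) → √2, because (2n + 1) u(n)²
-- decreases and 2n u(n)² increases, which squeezes y(N,k)² between 2 - (4k + 3) / (2N + 2k + 1) and 2.

open import Defs
open import Data.Integer.Base as ℤ using (+_; +[1+_]; -[1+_]; +<+)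
import Data.Integer.Properties as ℤ
open import Data.Nat.Base hiding (_/_)
open import Data.Nat.Combinatorics using (_C_; nCk≡n!/k![n-k]!; k![n∸k]!∣n!)
import Data.Nat.DivMod as ℕ
open import Data.Nat.Properties
open import Data.Nat.Tactic.RingSolver using () renaming (solve-∀ to solveℕ)
open import Data.Product.Base using (_,_; ∃-syntax)
open import Data.Rational.Base as ℚ using (ℚ; 0ℚ; 1ℚ; ½; mkℚ; toℚᵘ; _/_)
import Data.Rational.Properties as ℚ
open import Data.Rational.Unnormalised.Base as ℚᵘ using (mkℚᵘ)
import Data.Rational.Unnormalised.Properties as ℚᵘ
open import Data.Sum.Base using (inj₁; inj₂)
open import Level using (0ℓ)
open import Relation.Binary.PropositionalEquality
open import Relation.Nullary using (yes; no; contradiction)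
open import Relation.Nullary.Decidable using (dec⇒maybe)
open import Tactic.RingSolver using (solve-∀)
open import Tactic.RingSolver.Core.AlmostCommutativeRing using (AlmostCommutativeRing; fromCommutativeRing)

-- Fractions of natural numbers

ℚ-ring : AlmostCommutativeRing 0ℓ 0ℓ
ℚ-ring = fromCommutativeRing ℚ.+-*-commutativeRing (λ x → dec⇒maybe (0ℚ ℚ.≟ x))

infixl 7 _÷_

_÷_ : ℕ → (b : ℕ) → .{{NonZero b}} → ℚ
a ÷ b = + a / b

toℚᵘ-÷ : ∀ a b → toℚᵘ (a ÷ suc b) ℚᵘ.≃ mkℚᵘ (+ a) b
toℚᵘ-÷ a b = ℚ.toℚᵘ-fromℚᵘ (mkℚᵘ (+ a) b)

÷-cong : ∀ a b c d .{{_ : NonZero b}} .{{_ : NonZero d}} → a * d ≡ c * b → a ÷ b ≡ c ÷ d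
÷-cong a (suc b) c (suc d) eq = ℚ.fromℚᵘ-cong {mkℚᵘ (+ a) b} {mkℚᵘ (+ c) d}
  (ℚᵘ.*≡* (trans (sym (ℤ.pos-* a (suc d))) (trans (cong +_ eq) (ℤ.pos-* c (suc b)))))

÷-mono-≤ : ∀ a b c d .{{_ : NonZero b}} .{{_ : NonZero d}} → a * d ≤ c * b → a ÷ b ℚ.≤ c ÷ d
÷-mono-≤ a (suc b) c (suc d) h = ℚ.toℚᵘ-cancel-≤
  (ℚᵘ.≤-respˡ-≃ (ℚᵘ.≃-sym (toℚᵘ-÷ a b)) (ℚᵘ.≤-respʳ-≃ (ℚᵘ.≃-sym (toℚᵘ-÷ c d))
    (ℚᵘ.*≤* (subst₂ ℤ._≤_ (ℤ.pos-* a (suc d)) (ℤ.pos-* c (suc b)) (ℤ.+≤+ h)))))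

÷-* : ∀ a b c d .{{_ : NonZero b}} .{{_ : NonZero d}} →
      (a ÷ b) ℚ.* (c ÷ d) ≡ ((a * c) ÷ (b * d)) {{m*n≢0 b d}}
÷-* a (suc b) c (suc d) = ℚ.toℚᵘ-injective (ℚᵘ.≃-trans (ℚ.toℚᵘ-homo-* (a ÷ suc b) (c ÷ suc d))
  (ℚᵘ.≃-trans (ℚᵘ.*-cong (toℚᵘ-÷ a b) (toℚᵘ-÷ c d))
    (ℚᵘ.≃-trans (ℚᵘ.≃-reflexive (cong (λ z → mkℚᵘ z (d + b * suc d)) (sym (ℤ.pos-* a c))))
      (ℚᵘ.≃-sym (toℚᵘ-÷ (a * c) (d + b * suc d))))))

-- Cross-multiplication moves an equation between fractions into ℕ, where it is usually a polynomial
-- identity within reach of the solver.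
÷-*-cong : ∀ a b c d x y .{{_ : NonZero b}} .{{_ : NonZero d}} .{{_ : NonZero y}} →
           a * c * y ≡ x * (b * d) → (a ÷ b) ℚ.* (c ÷ d) ≡ x ÷ y
÷-*-cong a b c d x y eq = trans (÷-* a b c d) (÷-cong (a * c) (b * d) x y {{m*n≢0 b d}} eq)

÷-+ : ∀ a b d .{{_ : NonZero d}} → (a ÷ d) ℚ.+ (b ÷ d) ≡ (a + b) ÷ d
÷-+ a b (suc d) = ℚ.toℚᵘ-injective (ℚᵘ.≃-trans (ℚ.toℚᵘ-homo-+ (a ÷ suc d) (b ÷ suc d))
  (ℚᵘ.≃-trans (ℚᵘ.+-cong (toℚᵘ-÷ a d) (toℚᵘ-÷ b d))
    (ℚᵘ.≃-trans (ℚᵘ.*≡* eq) (ℚᵘ.≃-sym (toℚᵘ-÷ (a + b) d)))))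
  where
  eq : (+ a ℤ.* + suc d ℤ.+ + b ℤ.* + suc d) ℤ.* + suc d ≡ + (a + b) ℤ.* (+ suc d ℤ.* + suc d)
  eq = trans (cong (ℤ._* + suc d) (sym (ℤ.*-distribʳ-+ (+ suc d) (+ a) (+ b))))
    (trans (ℤ.*-assoc (+ a ℤ.+ + b) (+ suc d) (+ suc d)) (cong (ℤ._* (+ suc d ℤ.* + suc d)) (sym (ℤ.pos-+ a b))))

÷-nonNeg : ∀ a b .{{_ : NonZero b}} → ℚ.NonNegative (a ÷ b)
÷-nonNeg a b = ℚ.normalize-nonNeg a b

÷-pos : ∀ a b .{{_ : NonZero a}} .{{_ : NonZero b}} → ℚ.Positive (a ÷ b)
÷-pos a b = ℚ.normalize-pos a b

-- Central binomial coefficients and their normalization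

cb : ℕ → ℕ
cb n = (2 * n) C n

cb≢0 : ∀ n → NonZero (cb n)
cb≢0 n = C≢0 (m≤m+n n (n + 0))

nCk*k![n∸k]!≡n! : ∀ {n k} → k ≤ n → (n C k) * (k ! * (n ∸ k) !) ≡ n !
nCk*k![n∸k]!≡n! {n} {k} k≤n = trans (cong (_* (k ! * (n ∸ k) !)) (nCk≡n!/k![n-k]! k≤n))
  (ℕ.m/n*n≡m {{k !* (n ∸ k) !≢0}} (k![n∸k]!∣n! k≤n))

cb-factorial : ∀ n → cb n * (n ! * n !) ≡ (2 * n) !
cb-factorial n = subst (λ k → cb n * (n ! * k !) ≡ (2 * n) !) (trans (m+n∸m≡n n (n + 0)) (+-identityʳ n))
  (nCk*k![n∸k]!≡n! (m≤m+n n (n + 0)))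

-- After multiplication by (n + 1) n!² both sides equal (2n + 2)!.
cb-suc : ∀ n → suc n * cb (suc n) ≡ 2 * suc (2 * n) * cb n
cb-suc n = *-cancelˡ-≡ _ _ (suc n * (n ! * n !)) {{m*n≢0 (suc n) (n ! * n !) {{_}} {{n !* n !≢0}}}} (begin
  suc n * (n ! * n !) * (suc n * cb (suc n))               ≡⟨ lhs (suc n) (n !) (cb (suc n)) ⟩
  cb (suc n) * (suc n ! * suc n !)                         ≡⟨ cb-factorial (suc n) ⟩
  (2 * suc n) !                                            ≡⟨ cong _! (*-suc 2 n) ⟩
  suc (suc (2 * n)) * (suc (2 * n) * (2 * n) !)            ≡⟨ cong (λ t → suc (suc (2 * n)) * (suc (2 * n) * t)) (cb-factorial n) ⟨
  suc (suc (2 * n)) * (suc (2 * n) * (cb n * (n ! * n !))) ≡⟨ rhs n (n !) (cb n) ⟩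
  suc n * (n ! * n !) * (2 * suc (2 * n) * cb n)           ∎)
  where
  open ≡-Reasoning
  lhs : ∀ m f c → m * (f * f) * (m * c) ≡ c * ((m * f) * (m * f))
  lhs = solveℕ
  rhs : ∀ n f c → suc (suc (2 * n)) * (suc (2 * n) * (c * (f * f))) ≡ suc n * (f * f) * (2 * suc (2 * n) * c)
  rhs = solveℕ

-- `v n` is the reciprocal of `u n`. Both are defined by the ratio of consecutive terms, so one step
-- of either unfolds by computation, and a separate reciprocal sequence avoids dividing by `u`.
u v e : ℕ → ℚ
u zero    = 1ℚ
u (suc n) = u n ℚ.* (suc (2 * n) ÷ (2 * suc n))
v zero    = 1ℚ
v (suc n) = v n ℚ.* ((2 * suc n) ÷ suc (2 * n))
e n = u (2 * n)

u≡cb÷4^ : ∀ n → u n ≡ (cb n ÷ 4 ^ n) {{m^n≢0 4 n}}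
u≡cb÷4^ zero = refl
u≡cb÷4^ (suc n) = trans (cong (ℚ._* (suc (2 * n) ÷ (2 * suc n))) (u≡cb÷4^ n))
  (÷-*-cong (cb n) (4 ^ n) (suc (2 * n)) (2 * suc n) (cb (suc n)) (4 ^ suc n) {{m^n≢0 4 n}} {{_}} {{m^n≢0 4 (suc n)}} (begin
    cb n * suc (2 * n) * (4 * 4 ^ n)     ≡⟨ lhs (cb n) n (4 ^ n) ⟩
    2 * suc (2 * n) * cb n * (2 * 4 ^ n) ≡⟨ cong (_* (2 * 4 ^ n)) (cb-suc n) ⟨
    suc n * cb (suc n) * (2 * 4 ^ n)     ≡⟨ rhs (cb (suc n)) n (4 ^ n) ⟩
    cb (suc n) * (4 ^ n * (2 * suc n))   ∎))
  where
  open ≡-Reasoning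
  lhs : ∀ c n p → c * suc (2 * n) * (4 * p) ≡ 2 * suc (2 * n) * c * (2 * p)
  lhs = solveℕ
  rhs : ∀ c n p → suc n * c * (2 * p) ≡ c * (p * (2 * suc n))
  rhs = solveℕ

u*v≡1 : ∀ n → u n ℚ.* v n ≡ 1ℚ
u*v≡1 zero = refl
u*v≡1 (suc n) = trans (swap (u n) (suc (2 * n) ÷ (2 * suc n)) (v n) ((2 * suc n) ÷ suc (2 * n)))
  (cong₂ ℚ._*_ (u*v≡1 n) (÷-*-cong (suc (2 * n)) (2 * suc n) (2 * suc n) (suc (2 * n)) 1 1 (cross n)))
  where
  swap : ∀ a b c d → a ℚ.* b ℚ.* (c ℚ.* d) ≡ a ℚ.* c ℚ.* (b ℚ.* d)
  swap = solve-∀ ℚ-ring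
  cross : ∀ n → suc (2 * n) * (2 * suc n) * 1 ≡ 1 * (2 * suc n * suc (2 * n))
  cross = solveℕ

v≡4^÷cb : ∀ n → v n ≡ (4 ^ n ÷ cb n) {{cb≢0 n}}
v≡4^÷cb n = begin
  v n                      ≡⟨ ℚ.*-identityˡ (v n) ⟨
  1ℚ ℚ.* v n               ≡⟨ cong (ℚ._* v n) (÷-*-cong (4 ^ n) (cb n) (cb n) (4 ^ n) 1 1 (cross (4 ^ n) (cb n))) ⟨
  c⁻ ℚ.* c ℚ.* v n         ≡⟨ ℚ.*-assoc c⁻ c (v n) ⟩
  c⁻ ℚ.* (c ℚ.* v n)       ≡⟨ cong (λ t → c⁻ ℚ.* (t ℚ.* v n)) (u≡cb÷4^ n) ⟨
  c⁻ ℚ.* (u n ℚ.* v n)     ≡⟨ cong (c⁻ ℚ.*_) (u*v≡1 n) ⟩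
  c⁻ ℚ.* 1ℚ                ≡⟨ ℚ.*-identityʳ c⁻ ⟩
  c⁻                       ∎
  where
  open ≡-Reasoning
  instance
    _ = cb≢0 n
    _ = m^n≢0 4 n
  c c⁻ : ℚ
  c  = cb n ÷ 4 ^ n
  c⁻ = 4 ^ n ÷ cb n
  cross : ∀ p c → p * c * 1 ≡ 1 * (c * p)
  cross = solveℕ

e-suc : ∀ n → e (suc n) ≡ e n ℚ.* ((suc (4 * n) * (3 + 4 * n)) ÷ (8 * (suc (2 * n) * suc n)))
e-suc n = begin
  u (2 * suc n)     ≡⟨ cong u (*-suc 2 n) ⟩
  e n ℚ.* (suc (2 * (2 * n)) ÷ (2 * suc (2 * n))) ℚ.* (suc (2 * suc (2 * n)) ÷ (2 * suc (suc (2 * n))))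
    ≡⟨ ℚ.*-assoc (e n) (suc (2 * (2 * n)) ÷ (2 * suc (2 * n))) (suc (2 * suc (2 * n)) ÷ (2 * suc (suc (2 * n)))) ⟩
  e n ℚ.* ((suc (2 * (2 * n)) ÷ (2 * suc (2 * n))) ℚ.* (suc (2 * suc (2 * n)) ÷ (2 * suc (suc (2 * n)))))
    ≡⟨ cong (e n ℚ.*_) (÷-*-cong (suc (2 * (2 * n))) (2 * suc (2 * n)) (suc (2 * suc (2 * n))) (2 * suc (suc (2 * n)))
         (suc (4 * n) * (3 + 4 * n)) (8 * (suc (2 * n) * suc n)) (cross n)) ⟩
  e n ℚ.* ((suc (4 * n) * (3 + 4 * n)) ÷ (8 * (suc (2 * n) * suc n))) ∎
  where
  open ≡-Reasoning
  cross : ∀ n → suc (2 * (2 * n)) * suc (2 * suc (2 * n)) * (8 * (suc (2 * n) * suc n)) ≡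
                suc (4 * n) * (3 + 4 * n) * (2 * suc (2 * n) * (2 * suc (suc (2 * n))))
  cross = solveℕ

-- The Wilf-Zeilberger pair

y E g : ℕ → ℕ → ℚ
y N k = e N ℚ.* v (N + k) ℚ.* (suc (4 * N) ÷ suc (2 * (N + k)))
E N k = e k ℚ.* (1 ÷ (4 * suc (2 * k))) ℚ.* y N k
-- g p r is the term of index n = p + 1, so that 4 n - 1 = 3 + 4 p.
g p r = e (suc p) ℚ.* e r ℚ.* v (suc p + r) ℚ.* (r ÷ ((3 + 4 * p) * suc (p + r)))

module _ (p r : ℕ) where
  private
    -- The hypergeometric factor common to all four terms of the identity. Each term is `K` times a
    -- rational function with denominator `D`, so only the numerators remain to be compared.
    K : ℚ
    K = e (suc p) ℚ.* e r ℚ.* v (suc (p + r))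

    D : ℕ
    D = 4 * suc (2 * r) * (3 + 4 * p) * suc (p + r) * (3 + 2 * (p + r))

    -- The index 1 marks the shifted term, but the shift is in `p` for `E` and in `r` for `g`.
    E₁ E₀ g₁ g₀ : ℕ
    E₁ = (5 + 4 * p) * ((3 + 4 * p) * suc (p + r))
    g₀ = r * (4 * suc (2 * r) * (3 + 2 * (p + r)))
    E₀ = suc p * suc (2 * p) * (4 * (3 + 2 * (p + r)))
    g₁ = suc (4 * r) * (3 + 4 * r) * suc (p + r)

  E-suc : E (suc p) r ≡ K ℚ.* (E₁ ÷ D)
  E-suc = trans (move (e (suc p)) (e r) (v (suc p + r)) (1 ÷ (4 * suc (2 * r))) (suc (4 * suc p) ÷ suc (2 * (suc p + r))))
    (cong (K ℚ.*_) (÷-*-cong 1 (4 * suc (2 * r)) (suc (4 * suc p)) (suc (2 * suc (p + r))) E₁ D (cross p r)))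
    where
    move : ∀ a b c x y → b ℚ.* x ℚ.* (a ℚ.* c ℚ.* y) ≡ a ℚ.* b ℚ.* c ℚ.* (x ℚ.* y)
    move = solve-∀ ℚ-ring
    cross : ∀ p r → 1 * suc (4 * suc p) * (4 * suc (2 * r) * (3 + 4 * p) * suc (p + r) * (3 + 2 * (p + r))) ≡
                    (5 + 4 * p) * ((3 + 4 * p) * suc (p + r)) * (4 * suc (2 * r) * suc (2 * suc (p + r)))
    cross = solveℕ

  g-same : g p r ≡ K ℚ.* (g₀ ÷ D)
  g-same = cong (K ℚ.*_) (÷-cong r ((3 + 4 * p) * suc (p + r)) g₀ D (cross p r))
    where
    cross : ∀ p r → r * (4 * suc (2 * r) * (3 + 4 * p) * suc (p + r) * (3 + 2 * (p + r))) ≡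
                    r * (4 * suc (2 * r) * (3 + 2 * (p + r))) * ((3 + 4 * p) * suc (p + r))
    cross = solveℕ

  -- `K` is built from `e (suc p)` and `v (suc (p + r))`, one step beyond the factors of `E p r`.
  -- The chain therefore runs from right to left and unfolds `K`.
  E-same : E p r ≡ K ℚ.* (E₀ ÷ D)
  E-same = sym (begin
    e (suc p) ℚ.* e r ℚ.* (v (p + r) ℚ.* V) ℚ.* (E₀ ÷ D) ≡⟨ cong (λ t → t ℚ.* e r ℚ.* (v (p + r) ℚ.* V) ℚ.* (E₀ ÷ D)) (e-suc p) ⟩
    e p ℚ.* W ℚ.* e r ℚ.* (v (p + r) ℚ.* V) ℚ.* (E₀ ÷ D) ≡⟨ move (e p) W (e r) (v (p + r)) V (E₀ ÷ D) ⟩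
    e r ℚ.* (e p ℚ.* v (p + r) ℚ.* (W ℚ.* V ℚ.* (E₀ ÷ D))) ≡⟨ cong (λ t → e r ℚ.* (e p ℚ.* v (p + r) ℚ.* t)) quot ⟩
    e r ℚ.* (e p ℚ.* v (p + r) ℚ.* (X ℚ.* Y)) ≡⟨ move′ (e r) (e p) (v (p + r)) X Y ⟩
    E p r ∎)
    where
    open ≡-Reasoning
    V W X Y : ℚ
    V = (2 * suc (p + r)) ÷ suc (2 * (p + r))
    W = (suc (4 * p) * (3 + 4 * p)) ÷ (8 * (suc (2 * p) * suc p))
    X = 1 ÷ (4 * suc (2 * r))
    Y = suc (4 * p) ÷ suc (2 * (p + r))
    move : ∀ a w b c v d → a ℚ.* w ℚ.* b ℚ.* (c ℚ.* v) ℚ.* d ≡ b ℚ.* (a ℚ.* c ℚ.* (w ℚ.* v ℚ.* d))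
    move = solve-∀ ℚ-ring
    move′ : ∀ a b c x y → a ℚ.* (b ℚ.* c ℚ.* (x ℚ.* y)) ≡ a ℚ.* x ℚ.* (b ℚ.* c ℚ.* y)
    move′ = solve-∀ ℚ-ring
    -- The identity is pure cancellation of factors, so `cross` takes each linear factor as a
    -- variable, which keeps the polynomials small.
    WV : W ℚ.* V ≡ (suc (4 * p) * (3 + 4 * p) * suc (p + r)) ÷ (4 * (suc (2 * p) * suc p * suc (2 * (p + r))))
    WV = ÷-*-cong (suc (4 * p) * (3 + 4 * p)) (8 * (suc (2 * p) * suc p)) (2 * suc (p + r)) (suc (2 * (p + r)))
      (suc (4 * p) * (3 + 4 * p) * suc (p + r)) (4 * (suc (2 * p) * suc p * suc (2 * (p + r)))) (cross (suc (4 * p)) (3 + 4 * p) (suc (p + r)) (suc (2 * p)) (suc p) (suc (2 * (p + r))))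
      where
      cross : ∀ a b c d e f → a * b * (2 * c) * (4 * (d * e * f)) ≡ a * b * c * (8 * (d * e) * f)
      cross = solveℕ
    quot : W ℚ.* V ℚ.* (E₀ ÷ D) ≡ X ℚ.* Y
    quot = trans (cong (ℚ._* (E₀ ÷ D)) WV) (trans
      (÷-*-cong (suc (4 * p) * (3 + 4 * p) * suc (p + r)) (4 * (suc (2 * p) * suc p * suc (2 * (p + r)))) E₀ D
        (1 * suc (4 * p)) (4 * suc (2 * r) * suc (2 * (p + r))) (cross (suc (4 * p)) (3 + 4 * p) (suc (p + r)) (suc (2 * p)) (suc p) (suc (2 * (p + r))) (suc (2 * r)) (3 + 2 * (p + r))))
      (sym (÷-* 1 (4 * suc (2 * r)) (suc (4 * p)) (suc (2 * (p + r))))))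
      where
      cross : ∀ a b c d e f r h → a * b * c * (e * d * (4 * h)) * (4 * r * f) ≡ 1 * a * (4 * (d * e * f) * (4 * r * b * c * h))
      cross = solveℕ

  g-suc : g p (suc r) ≡ K ℚ.* (g₁ ÷ D)
  g-suc = begin
    g p (suc r)
      -- `suc p + suc r` reduces only to `suc (p + suc r)`; the next step of `v` unfolds once `suc`
      -- is moved outward.
      ≡⟨ cong (λ t → e (suc p) ℚ.* e (suc r) ℚ.* v (suc t) ℚ.* (suc r ÷ ((3 + 4 * p) * suc t))) (+-suc p r) ⟩
    e (suc p) ℚ.* e (suc r) ℚ.* (v (suc (p + r)) ℚ.* V) ℚ.* Z
      ≡⟨ cong (λ t → e (suc p) ℚ.* t ℚ.* (v (suc (p + r)) ℚ.* V) ℚ.* Z) (e-suc r) ⟩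
    e (suc p) ℚ.* (e r ℚ.* W) ℚ.* (v (suc (p + r)) ℚ.* V) ℚ.* Z
      ≡⟨ move (e (suc p)) (e r) W (v (suc (p + r))) V Z ⟩
    K ℚ.* (W ℚ.* (V ℚ.* Z))
      ≡⟨ cong (λ t → K ℚ.* (W ℚ.* t)) VZ ⟩
    K ℚ.* (W ℚ.* ((2 * suc r) ÷ ((3 + 2 * (p + r)) * (3 + 4 * p))))
      ≡⟨ cong (K ℚ.*_) (÷-*-cong (suc (4 * r) * (3 + 4 * r)) (8 * (suc (2 * r) * suc r)) (2 * suc r) ((3 + 2 * (p + r)) * (3 + 4 * p)) g₁ D
           (cross (suc (4 * r)) (3 + 4 * r) (suc r) (suc (2 * r)) (3 + 4 * p) (suc (p + r)) (3 + 2 * (p + r)))) ⟩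
    K ℚ.* (g₁ ÷ D) ∎
    where
    open ≡-Reasoning
    V W Z : ℚ
    V = (2 * suc (suc (p + r))) ÷ suc (2 * suc (p + r))
    W = (suc (4 * r) * (3 + 4 * r)) ÷ (8 * (suc (2 * r) * suc r))
    Z = suc r ÷ ((3 + 4 * p) * suc (suc (p + r)))
    move : ∀ a b w c v z → a ℚ.* (b ℚ.* w) ℚ.* (c ℚ.* v) ℚ.* z ≡ a ℚ.* b ℚ.* c ℚ.* (w ℚ.* (v ℚ.* z))
    move = solve-∀ ℚ-ring
    VZ : V ℚ.* Z ≡ (2 * suc r) ÷ ((3 + 2 * (p + r)) * (3 + 4 * p))
    VZ = ÷-*-cong (2 * suc (suc (p + r))) (suc (2 * suc (p + r))) (suc r) ((3 + 4 * p) * suc (suc (p + r))) (2 * suc r) ((3 + 2 * (p + r)) * (3 + 4 * p))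
      (cross′ (p + r) (suc r) (3 + 4 * p))
      where
      cross′ : ∀ m r a → 2 * suc (suc m) * r * ((3 + 2 * m) * a) ≡ 2 * r * (suc (2 * suc m) * (a * suc (suc m)))
      cross′ = solveℕ
    cross : ∀ a b c d f m h → a * b * (2 * c) * (4 * d * f * m * h) ≡ a * b * m * (8 * (d * c) * (h * f))
    cross = solveℕ

  -- The subtracted terms are moved across, so the numerators stay in ℕ and `numerators` is a
  -- polynomial identity there.
  wz-identity : E (suc p) r ℚ.+ g p r ≡ E p r ℚ.+ g p (suc r)
  wz-identity = begin
    E (suc p) r ℚ.+ g p r                   ≡⟨ cong₂ ℚ._+_ E-suc g-same ⟩
    K ℚ.* (E₁ ÷ D) ℚ.+ K ℚ.* (g₀ ÷ D)       ≡⟨ ℚ.*-distribˡ-+ K (E₁ ÷ D) (g₀ ÷ D) ⟨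
    K ℚ.* ((E₁ ÷ D) ℚ.+ (g₀ ÷ D))           ≡⟨ cong (K ℚ.*_) (÷-+ E₁ g₀ D) ⟩
    K ℚ.* ((E₁ + g₀) ÷ D)                   ≡⟨ cong (λ t → K ℚ.* (t ÷ D)) (numerators p r) ⟩
    K ℚ.* ((E₀ + g₁) ÷ D)                   ≡⟨ cong (K ℚ.*_) (÷-+ E₀ g₁ D) ⟨
    K ℚ.* ((E₀ ÷ D) ℚ.+ (g₁ ÷ D))           ≡⟨ ℚ.*-distribˡ-+ K (E₀ ÷ D) (g₁ ÷ D) ⟩
    K ℚ.* (E₀ ÷ D) ℚ.+ K ℚ.* (g₁ ÷ D)       ≡⟨ cong₂ ℚ._+_ E-same g-suc ⟨
    E p r ℚ.+ g p (suc r)                   ∎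
    where
    open ≡-Reasoning
    numerators : ∀ p r →
      (5 + 4 * p) * ((3 + 4 * p) * suc (p + r)) + r * (4 * suc (2 * r) * (3 + 2 * (p + r))) ≡
      suc p * suc (2 * p) * (4 * (3 + 2 * (p + r))) + suc (4 * r) * (3 + 4 * r) * suc (p + r)
    numerators = solveℕ

-- Telescoping in both variables

w : ℕ → ℚ
w r = e r ℚ.* v r

-- Divided by `w r`, the two terms on the left are 1 / (4(2r + 1)²) and (4r + 1)(4r + 3) / (4(2r +
-- 1)²), and 1 + (4r + 1)(4r + 3) = 4(2r + 1)². Thus `E 0` is the negated difference of `w`.
E₀+w-suc : ∀ r → E 0 r ℚ.+ w (suc r) ≡ w r
E₀+w-suc r = begin
  E 0 r ℚ.+ e (suc r) ℚ.* (v r ℚ.* V)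
    ≡⟨ cong (λ t → E 0 r ℚ.+ t ℚ.* (v r ℚ.* V)) (e-suc r) ⟩
  e r ℚ.* X ℚ.* (1ℚ ℚ.* v r ℚ.* Y) ℚ.+ e r ℚ.* W ℚ.* (v r ℚ.* V)
    ≡⟨ move (e r) X (v r) Y W V ⟩
  w r ℚ.* (X ℚ.* Y ℚ.+ W ℚ.* V)
    ≡⟨ cong (w r ℚ.*_) (cong₂ ℚ._+_
         (÷-* 1 (4 * suc (2 * r)) 1 (suc (2 * r)))
         (÷-*-cong (suc (4 * r) * (3 + 4 * r)) (8 * (suc (2 * r) * suc r)) (2 * suc r) (suc (2 * r)) (suc (4 * r) * (3 + 4 * r)) (4 * suc (2 * r) * suc (2 * r))
           (cross (suc (4 * r)) (3 + 4 * r) (suc r) (suc (2 * r))))) ⟩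
  w r ℚ.* ((1 ÷ (4 * suc (2 * r) * suc (2 * r))) ℚ.+ ((suc (4 * r) * (3 + 4 * r)) ÷ (4 * suc (2 * r) * suc (2 * r))))
    ≡⟨ cong (w r ℚ.*_) (trans (÷-+ 1 (suc (4 * r) * (3 + 4 * r)) (4 * suc (2 * r) * suc (2 * r)))
         (÷-cong (1 + suc (4 * r) * (3 + 4 * r)) (4 * suc (2 * r) * suc (2 * r)) 1 1 (one r))) ⟩
  w r ℚ.* 1ℚ
    ≡⟨ ℚ.*-identityʳ (w r) ⟩
  w r ∎
  where
  open ≡-Reasoning
  V W X Y : ℚ
  V = (2 * suc r) ÷ suc (2 * r)
  W = (suc (4 * r) * (3 + 4 * r)) ÷ (8 * (suc (2 * r) * suc r))
  X = 1 ÷ (4 * suc (2 * r))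
  Y = 1 ÷ suc (2 * r)
  move : ∀ a x b y w v → a ℚ.* x ℚ.* (1ℚ ℚ.* b ℚ.* y) ℚ.+ a ℚ.* w ℚ.* (b ℚ.* v) ≡ a ℚ.* b ℚ.* (x ℚ.* y ℚ.+ w ℚ.* v)
  move = solve-∀ ℚ-ring
  cross : ∀ a b c d → a * b * (2 * c) * (4 * d * d) ≡ a * b * (8 * (d * c) * d)
  cross = solveℕ
  one : ∀ r → (1 + suc (4 * r) * (3 + 4 * r)) * 1 ≡ 1 * (4 * suc (2 * r) * suc (2 * r))
  one = solveℕ

∑E₀ : ∀ r → ∑< r (E 0) ℚ.+ w r ≡ 1ℚ
∑E₀ zero    = refl
∑E₀ (suc r) = trans (ℚ.+-assoc (∑< r (E 0)) (E 0 r) (w (suc r)))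
  (trans (cong (∑< r (E 0) ℚ.+_) (E₀+w-suc r)) (∑E₀ r))

-- The Wilf-Zeilberger relation summed over the second variable; the terms of `g` telescope down to
-- `g p 0`, which vanishes because its numerator is 0.
∑E-suc : ∀ p r → ∑< r (E (suc p)) ≡ ∑< r (E p) ℚ.+ g p r
∑E-suc p zero    = sym (trans (cong (λ t → 0ℚ ℚ.+ K ℚ.* t) (÷-cong 0 ((3 + 4 * p) * suc (p + 0)) 0 1 refl)) (zero* K))
  where
  K : ℚ
  K = e (suc p) ℚ.* e 0 ℚ.* v (suc p + 0)
  zero* : ∀ x → 0ℚ ℚ.+ x ℚ.* 0ℚ ≡ 0ℚ
  zero* = solve-∀ ℚ-ring
∑E-suc p (suc r) = begin
  ∑< r (E (suc p)) ℚ.+ E (suc p) r              ≡⟨ cong (ℚ._+ E (suc p) r) (∑E-suc p r) ⟩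
  ∑< r (E p) ℚ.+ g p r ℚ.+ E (suc p) r          ≡⟨ move (∑< r (E p)) (g p r) (E (suc p) r) ⟩
  ∑< r (E p) ℚ.+ (E (suc p) r ℚ.+ g p r)        ≡⟨ cong (∑< r (E p) ℚ.+_) (wz-identity p r) ⟩
  ∑< r (E p) ℚ.+ (E p r ℚ.+ g p (suc r))        ≡⟨ ℚ.+-assoc (∑< r (E p)) (E p r) (g p (suc r)) ⟨
  ∑< r (E p) ℚ.+ E p r ℚ.+ g p (suc r)          ∎
  where
  open ≡-Reasoning
  move : ∀ a b c → a ℚ.+ b ℚ.+ c ≡ a ℚ.+ (c ℚ.+ b)
  move = solve-∀ ℚ-ring

-- Telescoping over the first variable, starting from the row `E 0`. It trades a sum of `N` terms of
-- `g` for a sum of only `r` terms, in which `N` can tend to infinity term by term.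
∑E : ∀ N r → ∑< r (E N) ℚ.+ w r ≡ 1ℚ ℚ.+ ∑< N (λ p → g p r)
∑E zero    r = trans (∑E₀ r) (sym (ℚ.+-identityʳ 1ℚ))
∑E (suc N) r = begin
  ∑< r (E (suc N)) ℚ.+ w r                       ≡⟨ cong (ℚ._+ w r) (∑E-suc N r) ⟩
  ∑< r (E N) ℚ.+ g N r ℚ.+ w r                   ≡⟨ move (∑< r (E N)) (g N r) (w r) ⟩
  ∑< r (E N) ℚ.+ w r ℚ.+ g N r                   ≡⟨ cong (ℚ._+ g N r) (∑E N r) ⟩
  1ℚ ℚ.+ ∑< N (λ p → g p r) ℚ.+ g N r            ≡⟨ ℚ.+-assoc 1ℚ (∑< N (λ p → g p r)) (g N r) ⟩
  1ℚ ℚ.+ ∑< (suc N) (λ p → g p r)                ∎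
  where
  open ≡-Reasoning
  move : ∀ a b c → a ℚ.+ b ℚ.+ c ≡ a ℚ.+ c ℚ.+ b
  move = solve-∀ ℚ-ring

-- Translation to the terms of the statement

4*k≡2*[2*k] : ∀ k → 4 * k ≡ 2 * (2 * k)
4*k≡2*[2*k] = solveℕ

4^[2n]≡4^n*4^n : ∀ n → 4 ^ (2 * n) ≡ 4 ^ n * 4 ^ n
4^[2n]≡4^n*4^n n = trans (cong (λ t → 4 ^ (n + t)) (+-identityʳ n)) (^-distribˡ-+-* 4 n n)

-- Spelled exactly as in `I`, so that `∑< r coeff` is the inner sum of `I r` by definition.
coeff : ℕ → ℚ
coeff k = (+ ((4 * k) C (2 * k)) / ((6 * k + 3) * 16 ^ k)) {{innerDenom≢0 k}}

6k+3≢0 : ∀ k → NonZero (6 * k + 3)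
6k+3≢0 k = subst NonZero (+-comm 3 (6 * k)) _

coeff≡ : ∀ k → coeff k ≡ e k ℚ.* (1 ÷ (6 * k + 3)) {{6k+3≢0 k}}
coeff≡ k = sym (trans (cong (ℚ._* (1 ÷ (6 * k + 3))) (u≡cb÷4^ (2 * k)))
  (÷-*-cong (cb (2 * k)) (4 ^ (2 * k)) 1 (6 * k + 3) ((4 * k) C (2 * k)) ((6 * k + 3) * 16 ^ k) (begin
    cb (2 * k) * 1 * ((6 * k + 3) * 16 ^ k)   ≡⟨ cong₂ (λ c q → c * 1 * ((6 * k + 3) * q)) (cong (_C (2 * k)) (sym (4*k≡2*[2*k] k))) (^-*-assoc 4 2 k) ⟩
    ((4 * k) C (2 * k)) * 1 * ((6 * k + 3) * 4 ^ (2 * k)) ≡⟨ move ((4 * k) C (2 * k)) (6 * k + 3) (4 ^ (2 * k)) ⟩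
    ((4 * k) C (2 * k)) * (4 ^ (2 * k) * (6 * k + 3)) ∎)))
  where
  open ≡-Reasoning
  instance
    _ = 6k+3≢0 k
    _ = m^n≢0 4 (2 * k)
    _ = innerDenom≢0 k
  move : ∀ c d q → c * 1 * (d * q) ≡ c * (q * d)
  move = solveℕ

-- Since (4/3) / (4(2k + 1)) = 1 / (6k + 3), the factor 4/3 turns `E N k` into the k-th term of
-- `I r` with `y N k` in place of √2.
4/3*E : ∀ N k → (4 ÷ 3) ℚ.* E N k ≡ coeff k ℚ.* y N k
4/3*E N k = begin
  (4 ÷ 3) ℚ.* (e k ℚ.* X ℚ.* y N k)         ≡⟨ move (4 ÷ 3) (e k) X (y N k) ⟩
  e k ℚ.* ((4 ÷ 3) ℚ.* X) ℚ.* y N k         ≡⟨ cong (λ t → e k ℚ.* t ℚ.* y N k) (÷-*-cong 4 3 1 (4 * suc (2 * k)) 1 (6 * k + 3) (cross k)) ⟩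
  e k ℚ.* (1 ÷ (6 * k + 3)) ℚ.* y N k       ≡⟨ cong (ℚ._* y N k) (coeff≡ k) ⟨
  coeff k ℚ.* y N k                         ∎
  where
  open ≡-Reasoning
  instance
    _ = 6k+3≢0 k
  X : ℚ
  X = 1 ÷ (4 * suc (2 * k))
  move : ∀ a b c d → a ℚ.* (b ℚ.* c ℚ.* d) ≡ b ℚ.* (a ℚ.* c) ℚ.* d
  move = solve-∀ ℚ-ring
  cross : ∀ k → 4 * 1 * (6 * k + 3) ≡ 1 * (3 * (4 * suc (2 * k)))
  cross = solveℕ

module _ (s : ℕ) where
  private
    r T c : ℕ
    r = suc s
    T = 4 ^ s
    c = cb (2 * r)

    instance
      T≢0 : NonZero T
      T≢0 = m^n≢0 4 s
      c≢0 : NonZero c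
      c≢0 = cb≢0 (2 * r)
      rc≢0 : NonZero (r * c)
      rc≢0 = m*n≢0 r c
      rT≢0 : NonZero (4 * T * r)
      rT≢0 = m*n≢0 (4 * T) r {{m*n≢0 4 T}}

  2^[2r∸2]≡4^s : 2 ^ (2 * r ∸ 2) ≡ T
  2^[2r∸2]≡4^s = trans (cong (λ t → 2 ^ (t ∸ 2)) (*-suc 2 s)) (sym (^-*-assoc 2 2 s))

  leading outer prefactor scale : ℚ
  leading   = (+ 1 / ((2 * r ∸ 1) * ((2 * r ∸ 2) C (r ∸ 1)))) {{leadDenom≢0 r}}
  outer     = (+ 1 / (2 ^ (2 * r ∸ 2))) {{m^n≢0 2 (2 * r ∸ 2)}}
  prefactor = (+ (6 * 16 ^ (r ∸ 1)) / (r * ((4 * r) C (2 * r)))) {{prefactorDenom≢0 r}}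
  scale     = outer ℚ.* prefactor

  scale≡ : scale ≡ (6 * T) ÷ (r * c)
  scale≡ = ÷-*-cong 1 (2 ^ (2 * r ∸ 2)) (6 * 16 ^ s) (r * ((4 * r) C (2 * r))) (6 * T) (r * c)
    {{m^n≢0 2 (2 * r ∸ 2)}} {{prefactorDenom≢0 r}} (begin
      1 * (6 * 16 ^ s) * (r * c)  ≡⟨ cong (λ t → 1 * (6 * t) * (r * c)) (trans (^-*-assoc 4 2 s) (4^[2n]≡4^n*4^n s)) ⟩
      1 * (6 * (T * T)) * (r * c) ≡⟨ move T (r * c) ⟩
      6 * T * (T * (r * c))       ≡⟨ cong₂ (λ t d → 6 * T * (t * (r * d))) (sym 2^[2r∸2]≡4^s) (cong (_C (2 * r)) (sym (4*k≡2*[2*k] r))) ⟩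
      6 * T * (2 ^ (2 * r ∸ 2) * (r * ((4 * r) C (2 * r)))) ∎)
    where
    open ≡-Reasoning
    move : ∀ t c → 1 * (6 * (t * t)) * c ≡ 6 * t * (t * c)
    move = solveℕ

  -- The binomial C(4r, 2r) in the denominator of the prefactor cancels the one in `e r`; only
  -- powers of 4 and `r` survive.
  4/3*scale*e : (4 ÷ 3) ℚ.* scale ℚ.* e r ≡ 2 ÷ (4 * T * r)
  4/3*scale*e = begin
    (4 ÷ 3) ℚ.* scale ℚ.* e r
      ≡⟨ cong₂ (λ x y → (4 ÷ 3) ℚ.* x ℚ.* y) scale≡ (u≡cb÷4^ (2 * r)) ⟩
    (4 ÷ 3) ℚ.* ((6 * T) ÷ (r * c)) ℚ.* (c ÷ 4 ^ (2 * r))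
      ≡⟨ cong (ℚ._* (c ÷ 4 ^ (2 * r))) (÷-*-cong 4 3 (6 * T) (r * c) (8 * T) (r * c) (cross₁ T (r * c))) ⟩
    ((8 * T) ÷ (r * c)) ℚ.* (c ÷ 4 ^ (2 * r))
      ≡⟨ ÷-*-cong (8 * T) (r * c) c (4 ^ (2 * r)) 2 (4 * T * r)
           (trans (cross₂ T c r) (cong (λ t → 2 * (r * c * t)) (sym (4^[2n]≡4^n*4^n r)))) ⟩
    2 ÷ (4 * T * r) ∎
    where
    open ≡-Reasoning
    instance
      _ = m^n≢0 4 (2 * r)
    cross₁ : ∀ t c → 4 * (6 * t) * c ≡ 8 * t * (3 * c)
    cross₁ = solveℕ
    cross₂ : ∀ t c r → 8 * t * c * (4 * t * r) ≡ 2 * (r * c * (4 * t * (4 * t)))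
    cross₂ = solveℕ

  -- This identifies the leading term of the claimed value as the scaled boundary term `w r` of the
  -- telescoping. The denominator C(2s, s) arises from unfolding `v r` by one step.
  leading≡ : leading ≡ (4 ÷ 3) ℚ.* scale ℚ.* w r
  leading≡ = sym (begin
    (4 ÷ 3) ℚ.* scale ℚ.* (e r ℚ.* v r)   ≡⟨ ℚ.*-assoc ((4 ÷ 3) ℚ.* scale) (e r) (v r) ⟨
    (4 ÷ 3) ℚ.* scale ℚ.* e r ℚ.* v r     ≡⟨ cong₂ ℚ._*_ 4/3*scale*e v≡ ⟩
    (2 ÷ (4 * T * r)) ℚ.* ((2 * r * T) ÷ (suc (2 * s) * cb s))
      ≡⟨ ÷-*-cong 2 (4 * T * r) (2 * r * T) (suc (2 * s) * cb s) 1 ((2 * r ∸ 1) * ((2 * r ∸ 2) C s))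
           -- Rewriting `2 * suc s` as `2 + 2 * s` lets the truncated subtractions compute.
           (trans (cong (λ t → 2 * (2 * r * T) * ((t ∸ 1) * ((t ∸ 2) C s))) (*-suc 2 s)) (cross T r (suc (2 * s) * cb s))) ⟩
    leading ∎)
    where
    open ≡-Reasoning
    instance
      _ = cb≢0 s
      _ = m*n≢0 (suc (2 * s)) (cb s)
      _ = leadDenom≢0 r
    v≡ : v r ≡ (2 * r * T) ÷ (suc (2 * s) * cb s)
    v≡ = trans (cong (ℚ._* ((2 * r) ÷ suc (2 * s))) (v≡4^÷cb s))
      (÷-*-cong T (cb s) (2 * r) (suc (2 * s)) (2 * r * T) (suc (2 * s) * cb s) (cross T (2 * r) (suc (2 * s)) (cb s)))
      where
      cross : ∀ t r o c → t * r * (o * c) ≡ r * t * (c * o)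
      cross = solveℕ
    cross : ∀ t r d → 2 * (2 * r * t) * d ≡ 1 * (4 * t * r * d)
    cross = solveℕ

  module _ (p : ℕ) where
    private
      -- With n = p + 1, `M` is n + r - 1, and `a` and `b` are the binomials C(4n - 2, 2n - 1) and
      -- C(2n + 2r - 2, n + r - 1) of the summand.
      P M a b : ℕ
      P = 4 ^ p
      M = suc (p + s)
      a = cb (suc (2 * p))
      b = cb M

      instance
        P≢0 : NonZero P
        P≢0 = m^n≢0 4 p
        b≢0 : NonZero b
        b≢0 = cb≢0 M
        ob≢0 : NonZero (suc (2 * M) * b)
        ob≢0 = m*n≢0 (suc (2 * M)) b
        den≢0 : NonZero (suc p * (4 * P) * (suc (2 * M) * b))
        den≢0 = m*n≢0 (suc p * (4 * P)) (suc (2 * M) * b) {{m*n≢0 (suc p) (4 * P) {{_}} {{m*n≢0 4 P}}}}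
        16PP≢0 : NonZero (16 * (P * P) * suc p)
        16PP≢0 = m*n≢0 (16 * (P * P)) (suc p) {{m*n≢0 16 (P * P) {{_}} {{m*n≢0 P P}}}}

    private
      common : ℚ
      common = a ÷ (suc p * (4 * P) * (suc (2 * M) * b))

      2n+2r : 2 * suc p + 2 * r ≡ suc (suc (2 * M))
      2n+2r = eq p s
        where
        eq : ∀ p s → 2 * suc p + 2 * suc s ≡ suc (suc (2 * suc (p + s)))
        eq = solveℕ

    summand≡common : summand r (suc p) ≡ common
    summand≡common = ÷-*-cong 1 (suc p * (2 * suc p + 2 * r ∸ 1) * 4 ^ suc p) ((4 * suc p ∸ 2) C (2 * suc p ∸ 1))
        ((2 * suc p + 2 * r ∸ 2) C (suc p + r ∸ 1)) a (suc p * (4 * P) * (suc (2 * M) * b))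
        {{summandDenom≢0 r (suc p)}} {{summandC≢0 r (suc p)}} (begin
      1 * ((4 * suc p ∸ 2) C (2 * suc p ∸ 1)) * (suc p * (4 * P) * (suc (2 * M) * b))
        ≡⟨ cong₂ (λ i j → 1 * ((i ∸ 2) C (j ∸ 1)) * (suc p * (4 * P) * (suc (2 * M) * b))) (4n p) (*-suc 2 p) ⟩
      1 * a * (suc p * (4 * P) * (suc (2 * M) * b))
        ≡⟨ cross a (suc p) (4 * P) (suc (2 * M)) b ⟩
      a * (suc p * suc (2 * M) * (4 * P) * b)
        ≡⟨ cong₂ (λ i j → a * (suc p * (i ∸ 1) * (4 * P) * ((i ∸ 2) C j))) (sym 2n+2r) (sym (+-suc p s)) ⟩
      a * (suc p * (2 * suc p + 2 * r ∸ 1) * 4 ^ suc p * ((2 * suc p + 2 * r ∸ 2) C (suc p + r ∸ 1))) ∎)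
      where
      open ≡-Reasoning
      4n : ∀ p → 4 * suc p ≡ suc (suc (2 * suc (2 * p)))
      4n = solveℕ
      cross : ∀ a n q o b → 1 * a * (n * q * (o * b)) ≡ a * (n * o * q * b)
      cross = solveℕ

    private
      -- Only one step of `u` is unfolded, down to the odd index 2p + 1, because the summand
      -- contains C(4p + 2, 2p + 1).
      e≡ : e (suc p) ≡ (a * (3 + 4 * p)) ÷ (16 * (P * P) * suc p)
      e≡ = trans (cong u (*-suc 2 p)) (trans (cong (ℚ._* (suc (2 * suc (2 * p)) ÷ (2 * suc (suc (2 * p))))) (u≡cb÷4^ (suc (2 * p))))
        (÷-*-cong a (4 ^ suc (2 * p)) (suc (2 * suc (2 * p))) (2 * suc (suc (2 * p))) (a * (3 + 4 * p)) (16 * (P * P) * suc p)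
          {{m^n≢0 4 (suc (2 * p))}} (trans (cross a p (P * P)) (cong (λ t → a * (3 + 4 * p) * (4 * t * (2 * suc (suc (2 * p))))) (sym (4^[2n]≡4^n*4^n p))))))
        where
        cross : ∀ a p q → a * suc (2 * suc (2 * p)) * (16 * q * suc p) ≡ a * (3 + 4 * p) * (4 * q * (2 * suc (suc (2 * p))))
        cross = solveℕ

      v≡ : v (suc M) ≡ (8 * (P * T) * suc M) ÷ (suc (2 * M) * b)
      v≡ = trans (cong (ℚ._* ((2 * suc M) ÷ suc (2 * M))) (v≡4^÷cb M))
        (÷-*-cong (4 ^ M) b (2 * suc M) (suc (2 * M)) (8 * (P * T) * suc M) (suc (2 * M) * b)
          (trans (cong (λ t → 4 * t * (2 * suc M) * (suc (2 * M) * b)) (^-distribˡ-+-* 4 p s)) (cross (P * T) (suc M) (suc (2 * M)) b)))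
        where
        cross : ∀ q m o b → 4 * q * (2 * m) * (o * b) ≡ 8 * q * m * (b * o)
        cross = solveℕ

    4/3*scale*g≡common : (4 ÷ 3) ℚ.* scale ℚ.* g p r ≡ common
    4/3*scale*g≡common = begin
      κ ℚ.* (e (suc p) ℚ.* e r ℚ.* v (suc p + r) ℚ.* (r ÷ ((3 + 4 * p) * suc (p + r))))
        ≡⟨ cong (λ t → κ ℚ.* (e (suc p) ℚ.* e r ℚ.* v (suc t) ℚ.* (r ÷ ((3 + 4 * p) * suc t)))) (+-suc p s) ⟩
      κ ℚ.* (e (suc p) ℚ.* e r ℚ.* v (suc M) ℚ.* (r ÷ ((3 + 4 * p) * suc M)))
        ≡⟨ move κ (e (suc p)) (e r) (v (suc M)) (r ÷ ((3 + 4 * p) * suc M)) ⟩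
      κ ℚ.* e r ℚ.* (r ÷ ((3 + 4 * p) * suc M)) ℚ.* (e (suc p) ℚ.* v (suc M))
        ≡⟨ cong₂ (λ x y → x ℚ.* (r ÷ ((3 + 4 * p) * suc M)) ℚ.* y) 4/3*scale*e (cong₂ ℚ._*_ e≡ v≡) ⟩
      (2 ÷ (4 * T * r)) ℚ.* (r ÷ ((3 + 4 * p) * suc M)) ℚ.* (((a * (3 + 4 * p)) ÷ (16 * (P * P) * suc p)) ℚ.* ((8 * (P * T) * suc M) ÷ (suc (2 * M) * b)))
        ≡⟨ cong₂ ℚ._*_
             (÷-*-cong 2 (4 * T * r) r ((3 + 4 * p) * suc M) 1 (2 * T * ((3 + 4 * p) * suc M)) (cross₁ T r ((3 + 4 * p) * suc M)))
             (÷-*-cong (a * (3 + 4 * p)) (16 * (P * P) * suc p) (8 * (P * T) * suc M) (suc (2 * M) * b)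
               (a * (3 + 4 * p) * (T * suc M)) (2 * P * suc p * (suc (2 * M) * b)) (cross₂ (a * (3 + 4 * p)) P T (suc M) (suc p) (suc (2 * M) * b))) ⟩
      (1 ÷ (2 * T * ((3 + 4 * p) * suc M))) ℚ.* ((a * (3 + 4 * p) * (T * suc M)) ÷ (2 * P * suc p * (suc (2 * M) * b)))
        ≡⟨ ÷-*-cong 1 (2 * T * ((3 + 4 * p) * suc M)) (a * (3 + 4 * p) * (T * suc M)) (2 * P * suc p * (suc (2 * M) * b))
             a (suc p * (4 * P) * (suc (2 * M) * b)) (cross₃ a (3 + 4 * p) T (suc M) P (suc p) (suc (2 * M) * b)) ⟩
      common ∎
      where
      open ≡-Reasoning
      κ : ℚ
      κ = (4 ÷ 3) ℚ.* scale
      instance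
        _ = m*n≢0 (2 * T) ((3 + 4 * p) * suc M) {{m*n≢0 2 T}}
        _ = m*n≢0 (2 * P * suc p) (suc (2 * M) * b) {{m*n≢0 (2 * P) (suc p) {{m*n≢0 2 P}}}}
      move : ∀ k x y z t → k ℚ.* (x ℚ.* y ℚ.* z ℚ.* t) ≡ k ℚ.* y ℚ.* t ℚ.* (x ℚ.* z)
      move = solve-∀ ℚ-ring
      cross₁ : ∀ t r d → 2 * r * (2 * t * d) ≡ 1 * (4 * t * r * d)
      cross₁ = solveℕ
      cross₂ : ∀ a p t m n b → a * (8 * (p * t) * m) * (2 * p * n * b) ≡ a * (t * m) * (16 * (p * p) * n * b)
      cross₂ = solveℕ
      cross₃ : ∀ a f t m p n b → 1 * (a * f * (t * m)) * (n * (4 * p) * b) ≡ a * (2 * t * (f * m) * (2 * p * n * b))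
      cross₃ = solveℕ

    summand≡ : summand r (suc p) ≡ (4 ÷ 3) ℚ.* scale ℚ.* g p r
    summand≡ = trans summand≡common (sym 4/3*scale*g≡common)

  ∑summand : ∀ N → ∑₁ N (summand r) ≡ (4 ÷ 3) ℚ.* scale ℚ.* ∑< N (λ p → g p r)
  ∑summand zero    = sym (ℚ.*-zeroʳ ((4 ÷ 3) ℚ.* scale))
  ∑summand (suc N) = trans (cong₂ ℚ._+_ (∑summand N) (summand≡ N))
    (sym (ℚ.*-distribˡ-+ ((4 ÷ 3) ℚ.* scale) (∑< N (λ p → g p r)) (g N r)))

-- Positivity and monotonicity of the Wallis-type sequences

m+d≡n⇒m≤n : ∀ {m n} d → m + d ≡ n → m ≤ n
m+d≡n⇒m≤n {m} d eq = subst (m ≤_) eq (m≤m+n m d)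

u-pos : ∀ n → ℚ.Positive (u n)
u-pos zero    = _
u-pos (suc n) = ℚ.pos*pos⇒pos (u n) {{u-pos n}} (suc (2 * n) ÷ (2 * suc n)) {{÷-pos (suc (2 * n)) (2 * suc n)}}

v-pos : ∀ n → ℚ.Positive (v n)
v-pos zero    = _
v-pos (suc n) = ℚ.pos*pos⇒pos (v n) {{v-pos n}} ((2 * suc n) ÷ suc (2 * n)) {{÷-pos (2 * suc n) (suc (2 * n))}}

square-nonNeg : ∀ p .{{_ : ℚ.Positive p}} → ℚ.NonNegative (p ℚ.* p)
square-nonNeg p = ℚ.pos⇒nonNeg (p ℚ.* p) {{ℚ.pos*pos⇒pos p p}}

step⇒mono : ∀ (f : ℕ → ℚ) → (∀ n → f n ℚ.≤ f (suc n)) → ∀ {m n} → m ≤′ n → f m ℚ.≤ f n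
step⇒mono f step ≤′-refl = ℚ.≤-refl
step⇒mono f step (≤′-step m≤n) = ℚ.≤-trans (step⇒mono f step m≤n) (step _)

step⇒anti : ∀ (f : ℕ → ℚ) → (∀ n → f (suc n) ℚ.≤ f n) → ∀ {m n} → m ≤′ n → f n ℚ.≤ f m
step⇒anti f step ≤′-refl = ℚ.≤-refl
step⇒anti f step (≤′-step m≤n) = ℚ.≤-trans (step _) (step⇒anti f step m≤n)

α β : ℕ → ℚ
α n = u n ℚ.* u n ℚ.* (suc (2 * n) ÷ 1)
β n = u n ℚ.* u n ℚ.* ((2 * n) ÷ 1)

u²-suc : ∀ n x → u (suc n) ℚ.* u (suc n) ℚ.* (x ÷ 1) ≡
  u n ℚ.* u n ℚ.* ((suc (2 * n) * suc (2 * n) * x) ÷ (2 * suc n * (2 * suc n)))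
u²-suc n x = trans (move (u n) a (x ÷ 1)) (cong (u n ℚ.* u n ℚ.*_) (trans
    (cong (ℚ._* (x ÷ 1)) (÷-* (suc (2 * n)) (2 * suc n) (suc (2 * n)) (2 * suc n)))
    (÷-*-cong (suc (2 * n) * suc (2 * n)) (2 * suc n * (2 * suc n)) x 1
      (suc (2 * n) * suc (2 * n) * x) (2 * suc n * (2 * suc n)) (cong (suc (2 * n) * suc (2 * n) * x *_) (sym (*-identityʳ _))))))
  where
  a = suc (2 * n) ÷ (2 * suc n)
  move : ∀ u a x → u ℚ.* a ℚ.* (u ℚ.* a) ℚ.* x ≡ u ℚ.* u ℚ.* (a ℚ.* a ℚ.* x)
  move = solve-∀ ℚ-ring

-- The ratio of consecutive terms is (2n + 1)(2n + 3) / (2n + 2)², and (2n + 1)(2n + 3) = (2n + 2)²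
-- - 1.
α-suc : ∀ n → α (suc n) ℚ.≤ α n
α-suc n = subst (ℚ._≤ α n) (sym (u²-suc n (suc (2 * suc n))))
  (ℚ.*-monoˡ-≤-nonNeg (u n ℚ.* u n) {{square-nonNeg (u n) {{u-pos n}}}}
    (÷-mono-≤ (suc (2 * n) * suc (2 * n) * suc (2 * suc n)) (2 * suc n * (2 * suc n)) (suc (2 * n)) 1
      (m+d≡n⇒m≤n (suc (2 * n)) (slack n))))
  where
  slack : ∀ n → suc (2 * n) * suc (2 * n) * suc (2 * suc n) * 1 + suc (2 * n) ≡ suc (2 * n) * (2 * suc n * (2 * suc n))
  slack = solveℕ

-- The step multiplies 2n by (2n + 1)² / (2n(2n + 2)) when n > 0, and (2n + 1)² = 2n(2n + 2) + 1;
-- clearing denominators also covers n = 0.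
β-suc : ∀ n → β n ℚ.≤ β (suc n)
β-suc n = subst (β n ℚ.≤_) (sym (u²-suc n (2 * suc n)))
  (ℚ.*-monoˡ-≤-nonNeg (u n ℚ.* u n) {{square-nonNeg (u n) {{u-pos n}}}}
    (÷-mono-≤ (2 * n) 1 (suc (2 * n) * suc (2 * n) * (2 * suc n)) (2 * suc n * (2 * suc n))
      (m+d≡n⇒m≤n (2 * suc n) (slack n))))
  where
  slack : ∀ n → 2 * n * (2 * suc n * (2 * suc n)) + 2 * suc n ≡ suc (2 * n) * suc (2 * n) * (2 * suc n) * 1
  slack = solveℕ

-- Squeezing the square of `y` towards 2

module _ (N k : ℕ) where
  private
    M : ℕ
    M = N + k
    -- `R` is what remains of the square of `y N k` after splitting off `α (2 * N)`. Its factor 1 /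
    -- u(M)² makes `α M ℚ.* R` and `β M ℚ.* R` explicit fractions, so comparing the indices M and 2N
    -- bounds the square.
    X R : ℚ
    X = suc (4 * N) ÷ (suc (2 * M) * suc (2 * M))
    R = v M ℚ.* v M ℚ.* X

    R-nonNeg : ℚ.NonNegative R
    R-nonNeg = ℚ.pos⇒nonNeg R {{ℚ.pos*pos⇒pos (v M ℚ.* v M) {{ℚ.pos*pos⇒pos (v M) {{v-pos M}} (v M) {{v-pos M}}}} X {{÷-pos (suc (4 * N)) (suc (2 * M) * suc (2 * M))}}}}

  y-nonNeg : 0ℚ ℚ.≤ y N k
  y-nonNeg = ℚ.<⇒≤ (ℚ.positive⁻¹ (y N k) {{ℚ.pos*pos⇒pos (e N ℚ.* v M) {{ℚ.pos*pos⇒pos (e N) {{u-pos (2 * N)}} (v M) {{v-pos M}}}} (suc (4 * N) ÷ suc (2 * M)) {{÷-pos (suc (4 * N)) (suc (2 * M))}}}})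

  y²≡ : y N k ℚ.* y N k ≡ α (2 * N) ℚ.* R
  y²≡ = trans (move (e N) (v M) (suc (4 * N) ÷ suc (2 * M)))
    (trans (cong (λ t → e N ℚ.* e N ℚ.* (v M ℚ.* v M ℚ.* t)) frac) (move′ (e N) (v M) (suc (2 * (2 * N)) ÷ 1) X))
    where
    move : ∀ e v a → e ℚ.* v ℚ.* a ℚ.* (e ℚ.* v ℚ.* a) ≡ e ℚ.* e ℚ.* (v ℚ.* v ℚ.* (a ℚ.* a))
    move = solve-∀ ℚ-ring
    move′ : ∀ e v b x → e ℚ.* e ℚ.* (v ℚ.* v ℚ.* (b ℚ.* x)) ≡ e ℚ.* e ℚ.* b ℚ.* (v ℚ.* v ℚ.* x)
    move′ = solve-∀ ℚ-ring
    cross : ∀ N d → suc (4 * N) * suc (4 * N) * (1 * d) ≡ suc (2 * (2 * N)) * suc (4 * N) * d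
    cross = solveℕ
    frac : (suc (4 * N) ÷ suc (2 * M)) ℚ.* (suc (4 * N) ÷ suc (2 * M)) ≡ (suc (2 * (2 * N)) ÷ 1) ℚ.* X
    frac = trans (÷-*-cong (suc (4 * N)) (suc (2 * M)) (suc (4 * N)) (suc (2 * M)) (suc (2 * (2 * N)) * suc (4 * N)) (1 * (suc (2 * M) * suc (2 * M)))
        (cross N (suc (2 * M) * suc (2 * M))))
      (sym (÷-* (suc (2 * (2 * N))) 1 (suc (4 * N)) (suc (2 * M) * suc (2 * M))))

  u²*R : ∀ x → u M ℚ.* u M ℚ.* (x ÷ 1) ℚ.* R ≡ (x * suc (4 * N)) ÷ (suc (2 * M) * suc (2 * M))
  u²*R x = trans (move (u M) (v M) (x ÷ 1) X) (trans (cong (λ t → t ℚ.* t ℚ.* ((x ÷ 1) ℚ.* X)) (u*v≡1 M))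
    (trans (ℚ.*-identityˡ ((x ÷ 1) ℚ.* X))
      (÷-*-cong x 1 (suc (4 * N)) (suc (2 * M) * suc (2 * M)) (x * suc (4 * N)) (suc (2 * M) * suc (2 * M)) (cong (x * suc (4 * N) *_) (sym (*-identityˡ _))))))
    where
    move : ∀ u v a x → u ℚ.* u ℚ.* a ℚ.* (v ℚ.* v ℚ.* x) ≡ u ℚ.* v ℚ.* (u ℚ.* v) ℚ.* (a ℚ.* x)
    move = solve-∀ ℚ-ring

  module _ (k≤N : k ≤ N) where
    private
      M≤2N : M ≤′ 2 * N
      M≤2N = ≤⇒≤′ (+-monoʳ-≤ N (≤-trans k≤N (m≤m+n N 0)))

    -- As M ≤ 2N, the square is at most `α M ℚ.* R` = (4N + 1) / (2M + 1), and 2(2M + 1) exceeds 4N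
    -- + 1 by 4k + 1.
    y²≤2 : y N k ℚ.* y N k ℚ.≤ 2 ÷ 1
    y²≤2 = begin
      y N k ℚ.* y N k     ≡⟨ y²≡ ⟩
      α (2 * N) ℚ.* R     ≤⟨ ℚ.*-monoʳ-≤-nonNeg R {{R-nonNeg}} (step⇒anti α α-suc M≤2N) ⟩
      α M ℚ.* R           ≡⟨ u²*R (suc (2 * M)) ⟩
      (suc (2 * M) * suc (4 * N)) ÷ (suc (2 * M) * suc (2 * M))
        ≤⟨ ÷-mono-≤ (suc (2 * M) * suc (4 * N)) (suc (2 * M) * suc (2 * M)) 2 1
             (m+d≡n⇒m≤n ((4 * k + 1) * suc (2 * M)) (slack N k)) ⟩
      2 ÷ 1 ∎
      where
      open ℚ.≤-Reasoning
      slack : ∀ N k → suc (2 * (N + k)) * suc (4 * N) * 1 + (4 * k + 1) * suc (2 * (N + k)) ≡ 2 * (suc (2 * (N + k)) * suc (2 * (N + k)))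
      slack = solveℕ

    2≤y²+ : 2 ÷ 1 ℚ.≤ y N k ℚ.* y N k ℚ.+ (3 + 4 * k) ÷ suc (2 * M)
    2≤y²+ = begin
      2 ÷ 1
        -- The correction comes from 2(2M + 1)² - 2M(4N + 1) = (4k + 3)(2M + 1) - (4k + 1).
        ≤⟨ ÷-mono-≤ 2 1 (2 * M * suc (4 * N) + (3 + 4 * k) * suc (2 * M)) (suc (2 * M) * suc (2 * M))
             (m+d≡n⇒m≤n (suc (4 * k)) (slack N k)) ⟩
      (2 * M * suc (4 * N) + (3 + 4 * k) * suc (2 * M)) ÷ (suc (2 * M) * suc (2 * M))
        ≡⟨ ÷-+ (2 * M * suc (4 * N)) ((3 + 4 * k) * suc (2 * M)) (suc (2 * M) * suc (2 * M)) ⟨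
      ((2 * M * suc (4 * N)) ÷ (suc (2 * M) * suc (2 * M))) ℚ.+ (((3 + 4 * k) * suc (2 * M)) ÷ (suc (2 * M) * suc (2 * M)))
        ≡⟨ cong₂ ℚ._+_ (sym (u²*R (2 * M)))
             (÷-cong ((3 + 4 * k) * suc (2 * M)) (suc (2 * M) * suc (2 * M)) (3 + 4 * k) (suc (2 * M)) (*-assoc (3 + 4 * k) (suc (2 * M)) (suc (2 * M)))) ⟩
      β M ℚ.* R ℚ.+ (3 + 4 * k) ÷ suc (2 * M)
        ≤⟨ ℚ.+-monoˡ-≤ ((3 + 4 * k) ÷ suc (2 * M)) (ℚ.*-monoʳ-≤-nonNeg R {{R-nonNeg}} (ℚ.≤-trans (step⇒mono β β-suc M≤2N) (β≤α (2 * N)))) ⟩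
      α (2 * N) ℚ.* R ℚ.+ (3 + 4 * k) ÷ suc (2 * M)
        ≡⟨ cong (ℚ._+ (3 + 4 * k) ÷ suc (2 * M)) y²≡ ⟨
      y N k ℚ.* y N k ℚ.+ (3 + 4 * k) ÷ suc (2 * M) ∎
      where
      open ℚ.≤-Reasoning
      slack : ∀ N k → 2 * (suc (2 * (N + k)) * suc (2 * (N + k))) + suc (4 * k) ≡ (2 * (N + k) * suc (4 * N) + (3 + 4 * k) * suc (2 * (N + k))) * 1
      slack = solveℕ
      β≤α : ∀ n → β n ℚ.≤ α n
      β≤α n = ℚ.*-monoˡ-≤-nonNeg (u n ℚ.* u n) {{square-nonNeg (u n) {{u-pos n}}}}
        (÷-mono-≤ (2 * n) 1 (suc (2 * n)) 1 (*-monoˡ-≤ 1 (n≤1+n (2 * n))))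

-- Estimates that pass from squares to their roots

∣∣-≤ : ∀ {p q} → p ℚ.≤ q → ℚ.- p ℚ.≤ q → ℚ.∣ p ∣ ℚ.≤ q
∣∣-≤ {p} {q} p≤q -p≤q with ℚ.∣p∣≡p∨∣p∣≡-p p
... | inj₁ eq = subst (ℚ._≤ q) (sym eq) p≤q
... | inj₂ eq = subst (ℚ._≤ q) (sym eq) -p≤q

p≤q+r⇒p-q≤r : ∀ p q {r} → p ℚ.≤ q ℚ.+ r → p ℚ.- q ℚ.≤ r
p≤q+r⇒p-q≤r p q {r} h = subst (p ℚ.- q ℚ.≤_) (cancel q r) (ℚ.+-monoˡ-≤ (ℚ.- q) h)
  where
  cancel : ∀ q r → q ℚ.+ r ℚ.+ ℚ.- q ≡ r
  cancel = solve-∀ ℚ-ring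

-‿- : ∀ p q → ℚ.- (p ℚ.- q) ≡ q ℚ.- p
-‿- = solve-∀ ℚ-ring

-p≤∣p∣ : ∀ p → ℚ.- p ℚ.≤ ℚ.∣ p ∣
-p≤∣p∣ p with ℚ.≤-total 0ℚ p
... | inj₁ 0≤p = ℚ.≤-trans (ℚ.neg-antimono-≤ 0≤p) (ℚ.0≤∣p∣ p)
... | inj₂ p≤0 = ℚ.≤-reflexive (trans (sym (ℚ.0≤p⇒∣p∣≡p (ℚ.neg-antimono-≤ p≤0))) (ℚ.∣-p∣≡∣p∣ p))

archimedean : ∀ c ε → 0ℚ ℚ.< ε → ∃[ N ] (∀ n → N ≤ n → c ÷ suc n ℚ.≤ ε)
archimedean c ε@(mkℚ (+ zero) _ _) (ℚ.*<* (+<+ ()))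
archimedean c ε@(mkℚ -[1+ p ] _ _) (ℚ.*<* ())
-- For ε = (p + 1) / (d + 1) the claim reads c(d + 1) ≤ (p + 1)(n + 1), so n ≥ c(d + 1) suffices.
archimedean c ε@(mkℚ +[1+ p ] d _) ε>0 = c * suc d , λ n N≤n →
  subst (c ÷ suc n ℚ.≤_) (ℚ.fromℚᵘ-toℚᵘ ε)
    (÷-mono-≤ c (suc n) (suc p) (suc d) (≤-trans N≤n (≤-trans (n≤1+n n) (m≤n*m (suc n) (suc p)))))

∣y²-2∣≤ : ∀ N k → k ≤ N → ℚ.∣ y N k ℚ.* y N k ℚ.- 2 ÷ 1 ∣ ℚ.≤ (3 + 4 * k) ÷ suc (2 * (N + k))
∣y²-2∣≤ N k k≤N = ∣∣-≤
  (p≤q+r⇒p-q≤r (y N k ℚ.* y N k) (2 ÷ 1) (ℚ.≤-trans (y²≤2 N k k≤N)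
    (subst (ℚ._≤ 2 ÷ 1 ℚ.+ δ) (ℚ.+-identityʳ (2 ÷ 1)) (ℚ.+-monoʳ-≤ (2 ÷ 1) (ℚ.nonNegative⁻¹ δ {{÷-nonNeg (3 + 4 * k) (suc (2 * (N + k)))}})))))
  (subst (ℚ._≤ δ) (sym (-‿- (y N k ℚ.* y N k) (2 ÷ 1))) (p≤q+r⇒p-q≤r (2 ÷ 1) (y N k ℚ.* y N k) (2≤y²+ N k k≤N)))
  where
  δ : ℚ
  δ = (3 + 4 * k) ÷ suc (2 * (N + k))

-- Otherwise s² ≤ 1, and 2 - s² would be at least 1. This keeps the approximations to √2 away from
-- 0.
∣s²-2∣<1⇒1≤s : ∀ s → 0ℚ ℚ.≤ s → ℚ.∣ s ℚ.* s ℚ.- 2 ÷ 1 ∣ ℚ.< 1ℚ → 1ℚ ℚ.≤ s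
∣s²-2∣<1⇒1≤s s 0≤s h with 1ℚ ℚ.≤? s
... | yes p = p
... | no ¬p = contradiction (ℚ.<-≤-trans h (begin
  1ℚ                         ≡⟨⟩
  2 ÷ 1 ℚ.- 1ℚ               ≤⟨ ℚ.+-monoʳ-≤ (2 ÷ 1) (ℚ.neg-antimono-≤ s²≤1) ⟩
  2 ÷ 1 ℚ.- s ℚ.* s          ≡⟨ -‿- (s ℚ.* s) (2 ÷ 1) ⟨
  ℚ.- (s ℚ.* s ℚ.- 2 ÷ 1)    ≤⟨ -p≤∣p∣ (s ℚ.* s ℚ.- 2 ÷ 1) ⟩
  ℚ.∣ s ℚ.* s ℚ.- 2 ÷ 1 ∣    ∎)) (ℚ.<-irrefl refl)
  where
  open ℚ.≤-Reasoning
  s≤1 : s ℚ.≤ 1ℚ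
  s≤1 = ℚ.<⇒≤ (ℚ.≰⇒> ¬p)
  s²≤1 : s ℚ.* s ℚ.≤ 1ℚ
  s²≤1 = ℚ.≤-trans (ℚ.*-monoˡ-≤-nonNeg s {{ℚ.nonNegative 0≤s}} s≤1) (subst (ℚ._≤ 1ℚ) (sym (ℚ.*-identityʳ s)) s≤1)

-- The factor p + q of p² - q² is at least 1. Two rationals with squares near 2 can thus be compared
-- without leaving ℚ.
∣p-q∣≤∣p²-c∣+∣q²-c∣ : ∀ p q c → 0ℚ ℚ.≤ p → 1ℚ ℚ.≤ q → ℚ.∣ p ℚ.- q ∣ ℚ.≤ ℚ.∣ p ℚ.* p ℚ.- c ∣ ℚ.+ ℚ.∣ q ℚ.* q ℚ.- c ∣
∣p-q∣≤∣p²-c∣+∣q²-c∣ p q c 0≤p 1≤q = begin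
  ℚ.∣ p ℚ.- q ∣                          ≡⟨ ℚ.*-identityʳ ℚ.∣ p ℚ.- q ∣ ⟨
  ℚ.∣ p ℚ.- q ∣ ℚ.* 1ℚ                   ≤⟨ ℚ.*-monoˡ-≤-nonNeg ℚ.∣ p ℚ.- q ∣ {{ℚ.∣-∣-nonNeg (p ℚ.- q)}} 1≤p+q ⟩
  ℚ.∣ p ℚ.- q ∣ ℚ.* (p ℚ.+ q)            ≡⟨ cong (ℚ.∣ p ℚ.- q ∣ ℚ.*_) (ℚ.0≤p⇒∣p∣≡p (ℚ.≤-trans (ℚ.nonNegative⁻¹ 1ℚ) 1≤p+q)) ⟨
  ℚ.∣ p ℚ.- q ∣ ℚ.* ℚ.∣ p ℚ.+ q ∣        ≡⟨ ℚ.∣p*q∣≡∣p∣*∣q∣ (p ℚ.- q) (p ℚ.+ q) ⟨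
  ℚ.∣ (p ℚ.- q) ℚ.* (p ℚ.+ q) ∣          ≡⟨ cong ℚ.∣_∣ (diff p q c) ⟩
  ℚ.∣ (p ℚ.* p ℚ.- c) ℚ.- (q ℚ.* q ℚ.- c) ∣        ≤⟨ ℚ.∣p-q∣≤∣p∣+∣q∣ (p ℚ.* p ℚ.- c) (q ℚ.* q ℚ.- c) ⟩
  ℚ.∣ p ℚ.* p ℚ.- c ∣ ℚ.+ ℚ.∣ q ℚ.* q ℚ.- c ∣ ∎
  where
  open ℚ.≤-Reasoning
  1≤p+q : 1ℚ ℚ.≤ p ℚ.+ q
  1≤p+q = ℚ.+-mono-≤ 0≤p 1≤q
  diff : ∀ p q c → (p ℚ.- q) ℚ.* (p ℚ.+ q) ≡ (p ℚ.* p ℚ.- c) ℚ.- (q ℚ.* q ℚ.- c)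
  diff = solve-∀ ℚ-ring

∣∑c*d∣≤∑c*η : ∀ r (c d : ℕ → ℚ) η → (∀ k → 0ℚ ℚ.≤ c k) → (∀ k → k < r → ℚ.∣ d k ∣ ℚ.≤ η) →
       ℚ.∣ ∑< r (λ k → c k ℚ.* d k) ∣ ℚ.≤ ∑< r c ℚ.* η
∣∑c*d∣≤∑c*η zero    c d η 0≤c d≤η = ℚ.≤-reflexive (sym (ℚ.*-zeroˡ η))
∣∑c*d∣≤∑c*η (suc r) c d η 0≤c d≤η = begin
  ℚ.∣ ∑< r (λ k → c k ℚ.* d k) ℚ.+ c r ℚ.* d r ∣         ≤⟨ ℚ.∣p+q∣≤∣p∣+∣q∣ (∑< r (λ k → c k ℚ.* d k)) (c r ℚ.* d r) ⟩
  ℚ.∣ ∑< r (λ k → c k ℚ.* d k) ∣ ℚ.+ ℚ.∣ c r ℚ.* d r ∣   ≤⟨ ℚ.+-mono-≤ (∣∑c*d∣≤∑c*η r c d η 0≤c (λ k k<r → d≤η k (m<n⇒m<1+n k<r))) last ⟩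
  ∑< r c ℚ.* η ℚ.+ c r ℚ.* η                             ≡⟨ ℚ.*-distribʳ-+ η (∑< r c) (c r) ⟨
  (∑< r c ℚ.+ c r) ℚ.* η                                 ∎
  where
  open ℚ.≤-Reasoning
  last : ℚ.∣ c r ℚ.* d r ∣ ℚ.≤ c r ℚ.* η
  last = begin
    ℚ.∣ c r ℚ.* d r ∣         ≡⟨ ℚ.∣p*q∣≡∣p∣*∣q∣ (c r) (d r) ⟩
    ℚ.∣ c r ∣ ℚ.* ℚ.∣ d r ∣   ≡⟨ cong (ℚ._* ℚ.∣ d r ∣) (ℚ.0≤p⇒∣p∣≡p (0≤c r)) ⟩
    c r ℚ.* ℚ.∣ d r ∣         ≤⟨ ℚ.*-monoˡ-≤-nonNeg (c r) {{ℚ.nonNegative (0≤c r)}} (d≤η r ≤-refl) ⟩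
    c r ℚ.* η                 ∎

-- The exact error of the partial sums

∑coeff*[y-σ] : ∀ N σ r → (4 ÷ 3) ℚ.* ∑< r (E N) ℚ.- σ ℚ.* ∑< r coeff ≡ ∑< r (λ k → coeff k ℚ.* (y N k ℚ.- σ))
∑coeff*[y-σ] N σ zero = base (4 ÷ 3) σ
  where
  base : ∀ a b → a ℚ.* 0ℚ ℚ.- b ℚ.* 0ℚ ≡ 0ℚ
  base = solve-∀ ℚ-ring
∑coeff*[y-σ] N σ (suc r) = begin
  (4 ÷ 3) ℚ.* (∑< r (E N) ℚ.+ E N r) ℚ.- σ ℚ.* (∑< r coeff ℚ.+ coeff r)
    ≡⟨ move (4 ÷ 3) (∑< r (E N)) (E N r) σ (∑< r coeff) (coeff r) ⟩
  ((4 ÷ 3) ℚ.* ∑< r (E N) ℚ.- σ ℚ.* ∑< r coeff) ℚ.+ ((4 ÷ 3) ℚ.* E N r ℚ.- σ ℚ.* coeff r)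
    ≡⟨ cong₂ (λ a b → a ℚ.+ (b ℚ.- σ ℚ.* coeff r)) (∑coeff*[y-σ] N σ r) (4/3*E N r) ⟩
  S ℚ.+ (coeff r ℚ.* y N r ℚ.- σ ℚ.* coeff r)
    ≡⟨ move′ S (coeff r) (y N r) σ ⟩
  S ℚ.+ coeff r ℚ.* (y N r ℚ.- σ) ∎
  where
  open ≡-Reasoning
  S : ℚ
  S = ∑< r (λ k → coeff k ℚ.* (y N k ℚ.- σ))
  move : ∀ t S E σ B b → t ℚ.* (S ℚ.+ E) ℚ.- σ ℚ.* (B ℚ.+ b) ≡ (t ℚ.* S ℚ.- σ ℚ.* B) ℚ.+ (t ℚ.* E ℚ.- σ ℚ.* b)
  move = solve-∀ ℚ-ring
  move′ : ∀ S c y σ → S ℚ.+ (c ℚ.* y ℚ.- σ ℚ.* c) ≡ S ℚ.+ c ℚ.* (y ℚ.- σ)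
  move′ = solve-∀ ℚ-ring

-- `σ` is an arbitrary rational standing for √2. By the telescoped identity the boundary terms
-- cancel, and the whole error is a fixed nonnegative combination of the differences between `y N k`
-- and `σ`.
partialSum-error : ∀ s N σ → ∑₁ N (summand (suc s)) ℚ.- (leading s ℚ.- outer s ℚ.* (prefactor s ℚ.* (4 ÷ 3 ℚ.- σ ℚ.* ∑< (suc s) coeff)))
  ≡ scale s ℚ.* ∑< (suc s) (λ k → coeff k ℚ.* (y N k ℚ.- σ))
partialSum-error s N σ = begin
  ∑₁ N (summand r) ℚ.- (leading s ℚ.- rest)
    ≡⟨ cong₂ (λ a b → a ℚ.- (b ℚ.- rest)) (∑summand s N) (leading≡ s) ⟩
  (4 ÷ 3) ℚ.* scale s ℚ.* G ℚ.- ((4 ÷ 3) ℚ.* scale s ℚ.* w r ℚ.- rest)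
    ≡⟨ move (4 ÷ 3) (outer s) (prefactor s) G (w r) σ B ⟩
  scale s ℚ.* ((4 ÷ 3) ℚ.* ((1ℚ ℚ.+ G) ℚ.- w r) ℚ.- σ ℚ.* B)
    ≡⟨ cong (λ t → scale s ℚ.* ((4 ÷ 3) ℚ.* (t ℚ.- w r) ℚ.- σ ℚ.* B)) (∑E N r) ⟨
  scale s ℚ.* ((4 ÷ 3) ℚ.* ((∑< r (E N) ℚ.+ w r) ℚ.- w r) ℚ.- σ ℚ.* B)
    ≡⟨ cong (λ t → scale s ℚ.* ((4 ÷ 3) ℚ.* t ℚ.- σ ℚ.* B)) (cancel (∑< r (E N)) (w r)) ⟩
  scale s ℚ.* ((4 ÷ 3) ℚ.* ∑< r (E N) ℚ.- σ ℚ.* B)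
    ≡⟨ cong (scale s ℚ.*_) (∑coeff*[y-σ] N σ r) ⟩
  scale s ℚ.* ∑< r (λ k → coeff k ℚ.* (y N k ℚ.- σ)) ∎
  where
  open ≡-Reasoning
  r : ℕ
  r = suc s
  B G rest : ℚ
  B = ∑< r coeff
  G = ∑< N (λ p → g p r)
  rest = outer s ℚ.* (prefactor s ℚ.* (4 ÷ 3 ℚ.- σ ℚ.* B))
  cancel : ∀ a b → (a ℚ.+ b) ℚ.- b ≡ a
  cancel = solve-∀ ℚ-ring
  move : ∀ t q p G w σ B → t ℚ.* (q ℚ.* p) ℚ.* G ℚ.- (t ℚ.* (q ℚ.* p) ℚ.* w ℚ.- q ℚ.* (p ℚ.* (t ℚ.- σ ℚ.* B)))
    ≡ q ℚ.* p ℚ.* (t ℚ.* ((1ℚ ℚ.+ G) ℚ.- w) ℚ.- σ ℚ.* B)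
  move = solve-∀ ℚ-ring

-- Convergence

coeff-nonNeg : ∀ k → 0ℚ ℚ.≤ coeff k
coeff-nonNeg k = ℚ.nonNegative⁻¹ (coeff k) {{÷-nonNeg ((4 * k) C (2 * k)) ((6 * k + 3) * 16 ^ k) {{innerDenom≢0 k}}}}

∑-nonNeg : ∀ r {f} → (∀ k → 0ℚ ℚ.≤ f k) → 0ℚ ℚ.≤ ∑< r f
∑-nonNeg zero    0≤f = ℚ.≤-refl
∑-nonNeg (suc r) 0≤f = ℚ.+-mono-≤ (∑-nonNeg r 0≤f) (0≤f r)

module Convergence (s : ℕ) (ε : ℚ) (ε>0 : 0ℚ ℚ.< ε) where
  r : ℕ
  r = suc s

  -- The added 1 makes the bound positive, hence invertible, from nonnegativity of the product
  -- alone.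
  bound : ℚ
  bound = scale s ℚ.* ∑< r coeff ℚ.+ 1ℚ

  scale-nonNeg : ℚ.NonNegative (scale s)
  scale-nonNeg = ℚ.nonNeg*nonNeg⇒nonNeg (outer s) {{÷-nonNeg 1 (2 ^ (2 * r ∸ 2)) {{m^n≢0 2 (2 * r ∸ 2)}}}}
    (prefactor s) {{÷-nonNeg (6 * 16 ^ s) (r * ((4 * r) C (2 * r))) {{prefactorDenom≢0 r}}}}

  instance
    bound-pos : ℚ.Positive bound
    bound-pos = ℚ.positive (ℚ.+-mono-≤-< (ℚ.nonNegative⁻¹ (scale s ℚ.* ∑< r coeff)
      {{ℚ.nonNeg*nonNeg⇒nonNeg (scale s) {{scale-nonNeg}} (∑< r coeff) {{ℚ.nonNegative (∑-nonNeg r coeff-nonNeg)}}}})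
      (ℚ.positive⁻¹ 1ℚ))
    bound≢0 : ℚ.NonZero bound
    bound≢0 = ℚ.pos⇒nonZero bound

  -- The tolerance ε / (2 `bound`) is spent twice: once on the square of `y N k` and once on the
  -- square of `σ`.
  η : ℚ
  η = ½ ℚ.* (ℚ.1/ bound ℚ.* ε)

  η>0 : 0ℚ ℚ.< η
  η>0 = ℚ.positive⁻¹ η {{ℚ.pos*pos⇒pos ½ (ℚ.1/ bound ℚ.* ε)
    {{ℚ.pos*pos⇒pos (ℚ.1/ bound) {{ℚ.1/pos⇒pos bound}} ε {{ℚ.positive ε>0}}}}}}

  bound*2η≡ε : bound ℚ.* (η ℚ.+ η) ≡ ε
  bound*2η≡ε = trans (move bound (ℚ.1/ bound) ε) (trans (cong (ℚ._* ε) (ℚ.*-inverseʳ bound)) (ℚ.*-identityˡ ε))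
    where
    halves : ∀ b h i e → b ℚ.* (h ℚ.* (i ℚ.* e) ℚ.+ h ℚ.* (i ℚ.* e)) ≡ b ℚ.* i ℚ.* ((h ℚ.+ h) ℚ.* e)
    halves = solve-∀ ℚ-ring
    move : ∀ b i e → b ℚ.* (½ ℚ.* (i ℚ.* e) ℚ.+ ½ ℚ.* (i ℚ.* e)) ≡ b ℚ.* i ℚ.* e
    -- The sum of the two halves computes to `1ℚ`, so `*-identityˡ` applies directly.
    move b i e = trans (halves b ½ i e) (cong (b ℚ.* i ℚ.*_) (ℚ.*-identityˡ e))

  -- The tolerance 1 forces `σ` to be at least 1, which allows the comparison of roots; the
  -- tolerance `η` then controls the distance. The bound on 4r / (N + 1) serves all k < r at once.
  ∣y-σ∣≤2η : ∀ σ N → 0ℚ ℚ.≤ σ → ℚ.∣ σ ℚ.* σ ℚ.- 2 ÷ 1 ∣ ℚ.< 1ℚ → ℚ.∣ σ ℚ.* σ ℚ.- 2 ÷ 1 ∣ ℚ.< η →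
    r ≤ N → (4 * r) ÷ suc N ℚ.≤ η → ∀ k → k < r → ℚ.∣ y N k ℚ.- σ ∣ ℚ.≤ η ℚ.+ η
  ∣y-σ∣≤2η σ N 0≤σ near₁ near r≤N small k k<r = begin
    ℚ.∣ y N k ℚ.- σ ∣
      ≤⟨ ∣p-q∣≤∣p²-c∣+∣q²-c∣ (y N k) σ (2 ÷ 1) (y-nonNeg N k) (∣s²-2∣<1⇒1≤s σ 0≤σ near₁) ⟩
    ℚ.∣ y N k ℚ.* y N k ℚ.- 2 ÷ 1 ∣ ℚ.+ ℚ.∣ σ ℚ.* σ ℚ.- 2 ÷ 1 ∣
      ≤⟨ ℚ.+-mono-≤ (ℚ.≤-trans (∣y²-2∣≤ N k (≤-trans (<⇒≤ k<r) r≤N)) (ℚ.≤-trans weaken small)) (ℚ.<⇒≤ near) ⟩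
    η ℚ.+ η ∎
    where
    open ℚ.≤-Reasoning
    3+4k≤4r : 3 + 4 * k ≤ 4 * r
    3+4k≤4r = ≤-trans (n≤1+n (3 + 4 * k)) (≤-trans (≤-reflexive (sym (*-suc 4 k))) (*-monoʳ-≤ 4 k<r))
    weaken : (3 + 4 * k) ÷ suc (2 * (N + k)) ℚ.≤ (4 * r) ÷ suc N
    weaken = ÷-mono-≤ (3 + 4 * k) (suc (2 * (N + k))) (4 * r) (suc N)
      (*-mono-≤ 3+4k≤4r (s≤s (≤-trans (m≤m+n N k) (m≤m+n (N + k) (N + k + 0)))))

  ∣error∣≤ε : ∀ σ N → (∀ k → k < r → ℚ.∣ y N k ℚ.- σ ∣ ℚ.≤ η ℚ.+ η) →
    ℚ.∣ scale s ℚ.* ∑< r (λ k → coeff k ℚ.* (y N k ℚ.- σ)) ∣ ℚ.≤ ε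
  ∣error∣≤ε σ N near = begin
    ℚ.∣ scale s ℚ.* S ∣                     ≡⟨ ℚ.∣p*q∣≡∣p∣*∣q∣ (scale s) S ⟩
    ℚ.∣ scale s ∣ ℚ.* ℚ.∣ S ∣               ≡⟨ cong (ℚ._* ℚ.∣ S ∣) (ℚ.0≤p⇒∣p∣≡p (ℚ.nonNegative⁻¹ (scale s) {{scale-nonNeg}})) ⟩
    scale s ℚ.* ℚ.∣ S ∣                     ≤⟨ ℚ.*-monoˡ-≤-nonNeg (scale s) {{scale-nonNeg}} (∣∑c*d∣≤∑c*η r coeff (λ k → y N k ℚ.- σ) (η ℚ.+ η) coeff-nonNeg near) ⟩
    scale s ℚ.* (∑< r coeff ℚ.* (η ℚ.+ η))  ≡⟨ ℚ.*-assoc (scale s) (∑< r coeff) (η ℚ.+ η) ⟨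
    scale s ℚ.* ∑< r coeff ℚ.* (η ℚ.+ η)    ≤⟨ ℚ.*-monoʳ-≤-nonNeg (η ℚ.+ η) {{ℚ.nonNegative (ℚ.<⇒≤ (ℚ.+-mono-< η>0 η>0))}} ≤bound ⟩
    bound ℚ.* (η ℚ.+ η)                     ≡⟨ bound*2η≡ε ⟩
    ε                                       ∎
    where
    open ℚ.≤-Reasoning
    S : ℚ
    S = ∑< r (λ k → coeff k ℚ.* (y N k ℚ.- σ))
    ≤bound : scale s ℚ.* ∑< r coeff ℚ.≤ bound
    ≤bound = subst (ℚ._≤ bound) (ℚ.+-identityʳ _) (ℚ.+-monoʳ-≤ (scale s ℚ.* ∑< r coeff) (ℚ.nonNegative⁻¹ 1ℚ))

theorem4p0p2 : (r : ℕ) → .{{_ : NonZero r}} →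
    ∑₁∞ summand r ≃
    fromℚ ((+ 1 / ((2 * r ∸ 1) * ((2 * r ∸ 2) C (r ∸ 1)))) {{leadDenom≢0 r}})
    -ℝ fromℚ ((+ 1 / (2 ^ (2 * r ∸ 2))) {{m^n≢0 2 (2 * r ∸ 2)}}) *ℝ I r
theorem4p0p2 (suc s) ε ε>0 =
  let open Convergence s ε ε>0
      N₀ , small = archimedean (4 * r) η η>0
      M₁ , near₁ = √-square 2 1ℚ (ℚ.positive⁻¹ 1ℚ)
      M₂ , near  = √-square 2 η η>0
  -- Beyond `N₀` the squares of `y N k` are within `η` of 2; beyond `r` the condition k ≤ N of the
  -- squeeze holds for every k < r. `M₁` and `M₂` supply the two tolerances for the approximation to
  -- √2.
  in N₀ ⊔ r , λ N N₀⊔r≤N ε′ ε′>0 → M₁ ⊔ M₂ , λ m M≤m →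
    let σ = √-seq 2 m
        0≤σ = ℚ.nonNegative⁻¹ σ {{÷-nonNeg (isqrt (2 * (suc m * suc m))) (suc m)}}
    in ℚ.≤-<-trans
         -- Real operations act termwise, so the m-th term of the difference is by definition the
         -- left side of `partialSum-error` at `σ`. The bound `ε` already holds there, and `ε′` only
         -- makes it strict.
         (subst (λ t → ℚ.∣ t ∣ ℚ.≤ ε) (sym (partialSum-error s N σ))
           (∣error∣≤ε σ N (∣y-σ∣≤2η σ N 0≤σ (near₁ m (m⊔n≤o⇒m≤o M₁ M₂ M≤m)) (near m (m⊔n≤o⇒n≤o M₁ M₂ M≤m))
             (m⊔n≤o⇒n≤o N₀ r N₀⊔r≤N) (small N (m⊔n≤o⇒m≤o N₀ r N₀⊔r≤N)))))
         (subst (ℚ._< ε ℚ.+ ε′) (ℚ.+-identityʳ ε) (ℚ.+-monoʳ-< ε ε′>0))
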